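{- Let $G$ be a chordal graph on $n$ vertices with clique number $\omega$, and let $k\ge\omega$. The Kempe dynamics on the $k$-colourings of $G$ has mixing time at most $\mathcal{O}(\omega n^2)$.
   Context: A graph is chordal if it has no induced cycle of length at least $4$; $\omega$ is the size of a largest clique. A $k$-colouring is a proper colouring with colours $\{1,\dots,k\}$. Given a $k$-colouring $\sigma$ and two colours $c_1,c_2$, a Kempe chain is a maximal connected subgraph all of whose vertices have colour $c_1$ or $c_2$; a Kempe exchange swaps the colours $c_1$ and $c_2$ on a Kempe chain, producing a new $k$-colouring. The Kempe dynamics is the Markov chain on $k$-colourings with transition probabilities $P(\alpha,\beta)=\frac{1}{nk}$ for $\alpha\ne\beta$ differing by a single Kempe exchange, $P(\alpha,\beta)=0$ for other $\alpha\neq\beta$, and the remaining mass on staying put. (Equivalently: choose a vertex $v$ and colour $c$ uniformly at random, let $C$ be the Kempe chain whose exchange recolours $v$ with $c$, and perform that exchange with probability $1/|C|$.) Its stationary distribution $\pi$ is uniform. The mixing time is $\min\{t : \max_{x}\|\nu^t_x-\pi\|_{TV}\le 1/4\}$, where $\nu^t_x$ is the distribution after $t$ steps from $x$. -}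

module Defs where

open import Data.Bool using (Bool; true; false; _∧_; _∨_; not; if_then_else_)
open import Data.Nat as ℕ using (ℕ; zero; suc; _≤_)
open import Data.Fin as Fin using (Fin; toℕ)
open import Data.Fin.Properties using () renaming (_≟_ to _≟F_)
open import Data.Vec as Vec using (Vec; []; _∷_; lookup)
open import Data.Vec.Properties using () renaming (≡-dec to ≡-decV)
open import Data.List as List using (List; []; _∷_; length; allFin; concatMap; filter; foldr; map)
open import Data.List.Relation.Unary.AllPairs using (AllPairs)
open import Data.List.Relation.Unary.All using (All)
open import Data.List.Relation.Unary.Unique.Propositional using (Unique)
open import Data.Integer using (+_)
open import Data.Rational as ℚ using (ℚ; 0ℚ; 1ℚ; _+_; _*_; _-_; ∣_∣; ½)
open import Data.Product using (Σ; _×_; _,_; ∃-syntax)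
open import Data.Sum using (_⊎_)
open import Data.Empty using (⊥)
open import Function using (_⇔_; _∘_)
open import Function.Definitions using (Injective)
open import Relation.Binary.PropositionalEquality using (_≡_; _≢_)
open import Relation.Nullary using (¬_; does)

record Graph (n : ℕ) : Set where
  field
    adj    : Fin n → Fin n → Bool
    sym    : ∀ u v → adj u v ≡ adj v u
    irrefl : ∀ v → adj v v ≡ false
open Graph public

Adj : ∀ {n} → Graph n → Fin n → Fin n → Set
Adj G u v = adj G u v ≡ true

CycNext : (m : ℕ) → Fin m → Fin m → Set
CycNext m i j = toℕ j ≡ suc (toℕ i) ⊎ (suc (toℕ i) ≡ m × toℕ j ≡ 0)

CycAdj : (m : ℕ) → Fin m → Fin m → Set
CycAdj m i j = CycNext m i j ⊎ CycNext m j i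

IsInducedCycle : ∀ {n} → Graph n → (m : ℕ) → (Fin m → Fin n) → Set
IsInducedCycle G m c =
  Injective _≡_ _≡_ c × (∀ i j → Adj G (c i) (c j) ⇔ CycAdj m i j)

Chordal : ∀ {n} → Graph n → Set
Chordal G = ∀ m → 4 ≤ m → (c : Fin _ → _) → ¬ IsInducedCycle G m c

IsClique : ∀ {n} → Graph n → List (Fin n) → Set
IsClique G S = Unique S × AllPairs (Adj G) S

IsCliqueNumber : ∀ {n} → Graph n → ℕ → Set
IsCliqueNumber G ω =
  (∃[ S ] (IsClique G S × length S ≡ ω)) ×
  (∀ S → IsClique G S → length S ≤ ω)

Col : ℕ → ℕ → Set
Col n k = Vec (Fin k) n

IsProper : ∀ {n k} → Graph n → Col n k → Set
IsProper G σ = ∀ u v → Adj G u v → lookup σ u ≢ lookup σ v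

anyFin : ∀ {n} → (Fin n → Bool) → Bool
anyFin f = foldr (λ i b → f i ∨ b) false (allFin _)

allFin? : ∀ {n} → (Fin n → Bool) → Bool
allFin? f = not (anyFin (not ∘ f))

_==F_ : ∀ {k} → Fin k → Fin k → Bool
a ==F b = does (a ≟F b)

_==C_ : ∀ {n k} → Col n k → Col n k → Bool
α ==C β = does (≡-decV _≟F_ α β)

isProperB : ∀ {n k} → Graph n → Col n k → Bool
isProperB G σ =
  allFin? λ u → allFin? λ v → not (adj G u v ∧ (lookup σ u ==F lookup σ v))

allCols : (n k : ℕ) → List (Col n k)
allCols zero    k = [] ∷ []
allCols (suc n) k = concatMap (λ c → map (c ∷_) (allCols n k)) (allFin k)

properCols : ∀ {n} → Graph n → (k : ℕ) → List (Col n k)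
properCols G k = filter (λ σ → isProperB G σ Data.Bool.≟ true) (allCols _ k)
  where import Data.Bool

reach : ∀ {n k} → Graph n → Col n k → Fin k → Fin k → Fin n → ℕ → Fin n → Bool
reach G α c₁ c₂ v zero    u = (u ==F v) ∧ good
  where good = (lookup α v ==F c₁) ∨ (lookup α v ==F c₂)
reach G α c₁ c₂ v (suc t) u =
  reach G α c₁ c₂ v t u ∨
  (((lookup α u ==F c₁) ∨ (lookup α u ==F c₂)) ∧
   anyFin (λ w → reach G α c₁ c₂ v t w ∧ adj G w u))

-- the (c₁,c₂)-Kempe chain of α containing v
-- (empty if v has neither colour; n-1 ≤ n steps suffice to reach the
-- whole connected component)
kempeChain : ∀ {n k} → Graph n → Col n k → Fin k → Fin k → Fin n → Fin n → Bool
kempeChain {n} G α c₁ c₂ v = reach G α c₁ c₂ v n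

swapCol : ∀ {k} → Fin k → Fin k → Fin k → Fin k
swapCol c₁ c₂ c = if c ==F c₁ then c₂ else (if c ==F c₂ then c₁ else c)

kempeExchange : ∀ {n k} → Graph n → Col n k → Fin k → Fin k → Fin n → Col n k
kempeExchange G α c₁ c₂ v =
  Vec.tabulate λ u →
    if kempeChain G α c₁ c₂ v u then swapCol c₁ c₂ (lookup α u) else lookup α u

kempeAdjB : ∀ {n k} → Graph n → Col n k → Col n k → Bool
kempeAdjB G α β =
  not (α ==C β) ∧
  anyFin (λ v → anyFin (λ c₁ → anyFin (λ c₂ → kempeExchange G α c₁ c₂ v ==C β)))

sumQ : ∀ {A : Set} → List A → (A → ℚ) → ℚ
sumQ xs f = foldr (λ x s → f x + s) 0ℚ xs

-- 1/m, with the convention 1/0 = 0 (only relevant for degenerate cases)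
inv : ℕ → ℚ
inv zero    = 0ℚ
inv (suc m) = + 1 ℚ./ suc m

offDiag : ∀ {n k} → Graph n → Col n k → Col n k → ℚ
offDiag {n} {k} G α β = if kempeAdjB G α β then inv (n ℕ.* k) else 0ℚ

P : ∀ {n} → Graph n → (k : ℕ) → Col n k → Col n k → ℚ
P G k α β =
  if α ==C β
  then 1ℚ - sumQ (properCols G k) (λ γ → if α ==C γ then 0ℚ else offDiag G α γ)
  else offDiag G α β

dist : ∀ {n} → Graph n → (k : ℕ) → Col n k → ℕ → Col n k → ℚ
dist G k x zero    y = if x ==C y then 1ℚ else 0ℚ
dist G k x (suc t) y = sumQ (properCols G k) (λ z → dist G k x t z * P G k z y)

uniform : ∀ {n} → Graph n → (k : ℕ) → Col n k → ℚ
uniform G k y = inv (length (properCols G k))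

tvDist : ∀ {n} → Graph n → (k : ℕ) → Col n k → ℕ → ℚ
tvDist G k x t =
  ½ * sumQ (properCols G k) (λ y → ∣ dist G k x t y - uniform G k y ∣)

MixingTimeAtMost : ∀ {n} → Graph n → (k : ℕ) → ℕ → Set
MixingTimeAtMost G k T =
  Σ ℕ λ t → t ≤ T × (∀ x → IsProper G x → tvDist G k x t ℚ.≤ (+ 1 ℚ./ 4))

{-# OPTIONS --safe #-}
-- A chordal graph has a perfect elimination ordering (Dirac): the earlier neighbours
-- of every vertex form a clique.  Along such an ordering a Kempe chain is reached from
-- its earliest vertex, its root, by paths of increasing rank, so a Kempe exchange is
-- named uniquely by its root v and the colour c that v receives, where c must not occur
-- among the earlier neighbours of v.  Hence the Kempe dynamics applies a uniformly
-- random map (v , c), doing nothing when c is blocked at v.  Apply the same maps to two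
-- colourings.  If they agree on the first ℓ vertices they continue to do so, and a
-- move (v , c) at the next vertex v with c not blocked makes them agree on ℓ + 1
-- vertices; at least k - ω + 1 ≥ k / ω colours are not blocked.  So the expected number
-- of steps until the two colourings coincide is at most n · nω, and after 4ωn² steps they
-- differ with probability at most 1/4 (Markov).  The kernel is symmetric, so the uniform
-- distribution is stationary and the coupling bounds the total variation distance.
module Submission where

open import Defs
open import Algebra.Core using (Op₂)
open import Algebra.Structures using (IsCommutativeRing; IsCommutativeSemiring)
open import Data.Bool using (Bool; true; false; _∧_; _∨_; not; if_then_else_)
import Data.Bool.Properties as Bool
open import Data.Empty using (⊥; ⊥-elim)
open import Data.Fin using (Fin; zero; suc; toℕ)
open import Data.Fin.Properties using (any?) renaming (_≟_ to _≟F_)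
open import Data.Fin.Subset using (_∈_) renaming (∣_∣ to card)
open import Data.Fin.Subset.Properties using (p⊂q⇒∣p∣<∣q∣; ∣p∣≤n)
import Data.Integer as ℤ
import Data.Integer.Properties as ℤ
open import Data.List as List using (List; []; _∷_; length; allFin; foldr; map; _++_; cartesianProduct; cartesianProductWith; concatMap; filter)
open import Data.List.Properties using (length-tabulate)
open import Data.List.Membership.Propositional using () renaming (_∈_ to _∈ₗ_)
open import Data.List.Membership.Propositional.Properties using (∈-allFin; ∈-filter⁺; ∈-filter⁻; ∈-cartesianProduct⁺; ∈-cartesianProductWith⁺)
open import Data.List.Relation.Unary.All as All using (All; []; _∷_)
import Data.List.Relation.Unary.All.Properties as All
open import Data.List.Relation.Unary.AllPairs using (AllPairs; []; _∷_)
open import Data.List.Relation.Unary.Any as Any using (Any; here; there)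
open import Data.List.Relation.Unary.Unique.Propositional using (Unique)
import Data.List.Relation.Unary.Unique.Propositional.Properties as Unique
open import Data.Nat as ℕ using (ℕ; zero; suc; _+_; _*_; _^_; _≤_; _<_; z≤n; s≤s)
import Data.Nat.Properties as ℕ
open import Data.Nat.Solver using (module +-*-Solver)
open import Data.Product using (Σ; _×_; _,_; proj₁; proj₂; ∃-syntax)
open import Data.Rational as ℚ using (ℚ; 0ℚ; 1ℚ; ½; ∣_∣)
import Data.Rational.Properties as ℚ
open import Data.Rational.Solver renaming (module +-*-Solver to ℚ-Solver)
open import Data.Rational.Unnormalised as ℚᵘ using (mkℚᵘ; *≡*)
import Data.Rational.Unnormalised.Properties as ℚᵘ
open import Data.Sum using (_⊎_; inj₁; inj₂; [_,_]′)
open import Data.Vec as Vec using (Vec; lookup; tabulate; []; _∷_)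
open import Data.Vec.Properties using (lookup∘tabulate; tabulate∘lookup; tabulate-cong; []=⇒lookup; lookup⇒[]=) renaming (≡-dec to ≡-decV)
import Data.Vec.Properties as Vec
open import Function using (_∘_; id; _⇔_; mk⇔)
open import Function.Bundles using (module Equivalence)
open import Level using (0ℓ)
open import Relation.Binary using (DecidableEquality; Rel; tri<; tri≈; tri>)
open import Relation.Binary.PropositionalEquality using (_≡_; _≢_; refl; cong; cong₂; subst; trans; module ≡-Reasoning) renaming (sym to ≡-sym)
open import Relation.Nullary using (¬_; Dec; yes; no; does; contradiction)
open import Relation.Nullary.Decidable using (dec-true; dec-false; _×-dec_; ¬?; _⊎-dec_; map′)
open Equivalence using (to; from)

-- Reachability and Kempe chains

-- The exchange on a chain `C` could be named by `|C|` pairs, one for each vertex of `C` with its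
-- new colour. Keeping only the pair at the root leaves exactly one of the `n * k` maps for each
-- colouring one exchange away, hence the weight `1/(n * k)` with no factor `1/|C|`. The diagonal
-- then agrees with that of `P` because rows sum to 1. The agreement of two colourings on an initial
-- segment is fragile in a general graph: a chain may leave the segment and return, so that its
-- trace there depends on colours that differ. Paths of increasing rank rule this out. No
-- expectation is formalised. Sequences of moves are counted in `ℕ`, and the hitting time estimate
-- and Markov's inequality become the single induction `uncoupled-bound`.

∨-true : ∀ x {y} → x ∨ y ≡ true → x ≡ true ⊎ y ≡ true
∨-true true  _ = inj₁ refl
∨-true false e = inj₂ e

∨-trueʳ : ∀ x {y} → y ≡ true → x ∨ y ≡ true
∨-trueʳ x refl = Bool.∨-zeroʳ x

∧-true : ∀ x {y} → x ∧ y ≡ true → x ≡ true × y ≡ true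
∧-true true e = refl , e

true≢false : ∀ {x} → x ≡ true → x ≡ false → ⊥
true≢false refl ()

does-true : ∀ {A : Set} (d : Dec A) → does d ≡ true → A
does-true (yes a) _ = a

module _ {n : ℕ} where

  anyFin-true : (f : Fin n → Bool) → anyFin f ≡ true → ∃[ i ] f i ≡ true
  anyFin-true f = go (allFin n)
    where
    go : ∀ is → foldr (λ i b → f i ∨ b) false is ≡ true → ∃[ i ] f i ≡ true
    go (i ∷ is) e with ∨-true (f i) e
    ... | inj₁ p = i , p
    ... | inj₂ q = go is q

  anyFin-intro : (f : Fin n → Bool) → ∀ i → f i ≡ true → anyFin f ≡ true
  anyFin-intro f i fi = go (∈-allFin i)
    where
    go : ∀ {is} → i ∈ₗ is → foldr (λ j b → f j ∨ b) false is ≡ true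
    go (here refl)       rewrite fi = refl
    go (there {j} i∈is) = ∨-trueʳ (f j) (go i∈is)

  allFin?-true : (f : Fin n → Bool) → allFin? f ≡ true → ∀ i → f i ≡ true
  allFin?-true f e i with f i in fi
  ... | true  = refl
  ... | false = ⊥-elim (true≢false (anyFin-intro (not ∘ f) i (cong not fi)) (Bool.not-injective e))

  allFin?-intro : (f : Fin n → Bool) → (∀ i → f i ≡ true) → allFin? f ≡ true
  allFin?-intro f all with anyFin (not ∘ f) in e
  ... | false = refl
  ... | true with anyFin-true (not ∘ f) e
  ...   | i , ¬fi = ⊥-elim (true≢false ¬fi (cong not (all i)))

  cardB : (Fin n → Bool) → ℕ
  cardB f = card (tabulate f)

  cardB≤n : ∀ f → cardB f ≤ n
  cardB≤n f = ∣p∣≤n (tabulate f)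

  cardB-< : ∀ {f g : Fin n → Bool} → (∀ u → f u ≡ true → g u ≡ true) →
            ∀ v → g v ≡ true → f v ≡ false → cardB f < cardB g
  cardB-< {f} {g} f⊆g v gv fv = p⊂q⇒∣p∣<∣q∣
    ((λ {u} u∈f → mem g (f⊆g u (mem⁻ f u∈f))) , v , mem g gv , λ v∈f → true≢false (mem⁻ f v∈f) fv)
    where
    mem : ∀ h {u} → h u ≡ true → u ∈ tabulate h
    mem h {u} hu = lookup⇒[]= u (tabulate h) (trans (lookup∘tabulate h u) hu)
    mem⁻ : ∀ h {u} → u ∈ tabulate h → h u ≡ true
    mem⁻ h {u} u∈h = trans (≡-sym (lookup∘tabulate h u)) ([]=⇒lookup u∈h)

  data Conn (G : Graph n) (W : Fin n → Set) (v : Fin n) : Fin n → Set where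
    here : W v → Conn G W v v
    step : ∀ {w u} → Conn G W v w → Adj G w u → W u → Conn G W v u

  Adj-sym : ∀ (G : Graph n) {u v} → Adj G u v → Adj G v u
  Adj-sym G {u} {v} uv = trans (Graph.sym G v u) uv

  ¬Adj-refl : ∀ (G : Graph n) {u} → ¬ Adj G u u
  ¬Adj-refl G {u} uu = true≢false uu (irrefl G u)

  module _ {G : Graph n} {W : Fin n → Set} where

    Conn-start : ∀ {v u} → Conn G W v u → W v
    Conn-start (here Wv)    = Wv
    Conn-start (step c _ _) = Conn-start c

    Conn-end : ∀ {v u} → Conn G W v u → W u
    Conn-end (here Wv)     = Wv
    Conn-end (step _ _ Wu) = Wu

    Conn-trans : ∀ {v w u} → Conn G W v w → Conn G W w u → Conn G W v u
    Conn-trans c (here _)      = c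
    Conn-trans c (step d a Wu) = step (Conn-trans c d) a Wu

    Conn-sym : ∀ {v u} → Conn G W v u → Conn G W u v
    Conn-sym (here Wv)     = here Wv
    Conn-sym (step c a Wu) = Conn-trans (step (here Wu) (Adj-sym G a) (Conn-end c)) (Conn-sym c)

  Conn-map : ∀ {G : Graph n} {W W′ : Fin n → Set} {v u} → (∀ {x} → W x → W′ x) →
             Conn G W v u → Conn G W′ v u
  Conn-map f (here Wv)     = here (f Wv)
  Conn-map f (step c a Wu) = step (Conn-map f c) a (f Wu)

  InPair : ∀ {k} → Col n k → Fin k → Fin k → Fin n → Set
  InPair α c₁ c₂ u = lookup α u ≡ c₁ ⊎ lookup α u ≡ c₂

  module _ {k} (G : Graph n) (α : Col n k) (c₁ c₂ : Fin k) (v : Fin n) where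

    private
      W : Fin n → Set
      W = InPair α c₁ c₂

      WB : Fin n → Bool
      WB u = (lookup α u ==F c₁) ∨ (lookup α u ==F c₂)

      R : ℕ → Fin n → Bool
      R = reach G α c₁ c₂ v

      WB-true : ∀ {u} → WB u ≡ true → W u
      WB-true {u} e with ∨-true (lookup α u ==F c₁) e
      ... | inj₁ p = inj₁ (does-true (_ ≟F _) p)
      ... | inj₂ p = inj₂ (does-true (_ ≟F _) p)

      WB-intro : ∀ {u} → W u → WB u ≡ true
      WB-intro     (inj₁ p) rewrite dec-true (_ ≟F c₁) p = refl
      WB-intro {u} (inj₂ p) = ∨-trueʳ (lookup α u ==F c₁) (dec-true (_ ≟F c₂) p)

      reach-sound : ∀ t {u} → R t u ≡ true → Conn G W v u
      reach-sound zero {u} e with ∧-true (u ==F v) e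
      ... | u≡v , g with does-true (u ≟F v) u≡v
      ...   | refl = here (WB-true g)
      reach-sound (suc t) {u} e with ∨-true (R t u) e
      ... | inj₁ p = reach-sound t p
      ... | inj₂ q with ∧-true (WB u) q
      ...   | g , p with anyFin-true _ p
      ...     | w , r with ∧-true (R t w) r
      ...       | Rw , a = step (reach-sound t Rw) a (WB-true g)

      reach-suc : ∀ t {u} → R t u ≡ true → R (suc t) u ≡ true
      reach-suc t e rewrite e = refl

      reach-next : ∀ t {w u} → R t w ≡ true → Adj G w u → W u → R (suc t) u ≡ true
      reach-next t {w} {u} Rw a Wu = ∨-trueʳ (R t u)
        (cong₂ _∧_ (WB-intro Wu) (anyFin-intro _ w (cong₂ _∧_ Rw a)))

      Closed : ℕ → Set
      Closed t = ∀ u → R (suc t) u ≡ true → R t u ≡ true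

      Closed-suc : ∀ t → Closed t → Closed (suc t)
      Closed-suc t cl u e with ∨-true (R (suc t) u) e
      ... | inj₁ p = p
      ... | inj₂ q with ∧-true (WB u) q
      ...   | g , p with anyFin-true _ p
      ...     | w , r with ∧-true (R (suc t) w) r
      ...       | Rw , a = reach-next t (cl w Rw) a (WB-true g)

      -- The reached sets increase and stay constant once two consecutive ones coincide; until then
      -- every step adds a vertex. At `t = n` both alternatives make the set closed.
      closed-or-large : ∀ t → Closed t ⊎ t ≤ cardB (R t)
      closed-or-large zero = inj₂ z≤n
      closed-or-large (suc t) with closed-or-large t
      ... | inj₁ cl = inj₁ (Closed-suc t cl)
      ... | inj₂ t≤ with any? (λ u → (R (suc t) u Bool.≟ true) ×-dec (R t u Bool.≟ false))
      ...   | yes (u , new , old) = inj₂ (ℕ.≤-trans (s≤s t≤) (cardB-< (λ _ → reach-suc t) u new old))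
      ...   | no none = inj₁ (Closed-suc t λ u e → Bool.¬-not λ e′ → none (u , e , e′))

      full : ∀ (f : Fin n → Bool) → n ≤ cardB f → ∀ u → f u ≡ true
      full f n≤ u with f u in fu
      ... | true  = refl
      ... | false = contradiction (ℕ.≤-trans (cardB-< {g = λ _ → true} (λ _ _ → refl) u refl fu)
                                             (cardB≤n _))
                                  (ℕ.≤⇒≯ n≤)

      closed : Closed n
      closed with closed-or-large n
      ... | inj₁ cl = cl
      ... | inj₂ n≤ = λ u _ → full (R n) n≤ u

      reach-zero⇒ : ∀ t {u} → R 0 u ≡ true → R t u ≡ true
      reach-zero⇒ zero    e = e
      reach-zero⇒ (suc t) e = reach-suc t (reach-zero⇒ t e)

    kempeChain-sound : ∀ {u} → kempeChain G α c₁ c₂ v u ≡ true → Conn G (InPair α c₁ c₂) v u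
    kempeChain-sound = reach-sound n

    kempeChain-complete : ∀ {u} → Conn G (InPair α c₁ c₂) v u → kempeChain G α c₁ c₂ v u ≡ true
    kempeChain-complete (here Wv) = reach-zero⇒ n (cong₂ _∧_ (dec-true (v ≟F v) refl) (WB-intro Wv))
    kempeChain-complete (step c a Wu) = closed _ (reach-next n (kempeChain-complete c) a Wu)

    Conn-InPair? : ∀ u → Dec (Conn G (InPair α c₁ c₂) v u)
    Conn-InPair? u = map′ kempeChain-sound kempeChain-complete (kempeChain G α c₁ c₂ v u Bool.≟ true)

-- Perfect elimination orderings

module _ {n : ℕ} (G : Graph n) where

  Adj? : ∀ u v → Dec (Adj G u v)
  Adj? u v = adj G u v Bool.≟ true

  -- Induced paths and the cycles they close

  private
    Near Far : Fin n → Fin n → Set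
    Near a w = Adj G a w ⊎ a ≡ w
    Far a w = ¬ Near a w

    Near? : ∀ a w → Dec (Near a w)
    Near? a w = Adj? a w ⊎-dec (a ≟F w)

    Succ : ∀ {m} → Fin m → Fin m → Set
    Succ i j = toℕ j ≡ suc (toℕ i)

    Induced : List (Fin n) → Set
    Induced q = ∀ i j → Adj G (List.lookup q i) (List.lookup q j) ⇔ (Succ i j ⊎ Succ j i)

    Inj : List (Fin n) → Set
    Inj q = ∀ {i j} → List.lookup q i ≡ List.lookup q j → i ≡ j

    lookup-All : ∀ {Q : Fin n → Set} {q} → All Q q → ∀ i → Q (List.lookup q i)
    lookup-All (px ∷ _)  zero    = px
    lookup-All (_ ∷ pxs) (suc i) = lookup-All pxs i

    Inj-∷ : ∀ {a q} → (∀ i → a ≢ List.lookup q i) → Inj q → Inj (a ∷ q)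
    Inj-∷ a∉ inj {zero}  {zero}  _ = refl
    Inj-∷ a∉ inj {zero}  {suc j} e = contradiction e (a∉ j)
    Inj-∷ a∉ inj {suc i} {zero}  e = contradiction (≡-sym e) (a∉ i)
    Inj-∷ a∉ inj {suc i} {suc j} e = cong suc (inj e)

    Induced-[_] : ∀ a → Induced (a ∷ [])
    Induced-[ a ] zero zero = mk⇔ (⊥-elim ∘ ¬Adj-refl G) λ { (inj₁ ()) ; (inj₂ ()) }

    Induced-∷ : ∀ {a b q} → Adj G a b → All (Far a) q → Induced (b ∷ q) → Induced (a ∷ b ∷ q)
    Induced-∷ ab far ind zero zero = mk⇔ (⊥-elim ∘ ¬Adj-refl G) λ { (inj₁ ()) ; (inj₂ ()) }
    Induced-∷ ab far ind zero (suc zero) = mk⇔ (λ _ → inj₁ refl) (λ _ → ab)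
    Induced-∷ ab far ind zero (suc (suc j)) =
      mk⇔ (λ aj → contradiction (inj₁ aj) (lookup-All far j)) λ { (inj₁ ()) ; (inj₂ ()) }
    Induced-∷ ab far ind (suc zero) zero = mk⇔ (λ _ → inj₂ refl) (λ _ → Adj-sym G ab)
    Induced-∷ ab far ind (suc (suc j)) zero =
      mk⇔ (λ ja → contradiction (inj₁ (Adj-sym G ja)) (lookup-All far j)) λ { (inj₁ ()) ; (inj₂ ()) }
    Induced-∷ ab far ind (suc i) (suc j) = mk⇔
      ([ inj₁ ∘ cong suc , inj₂ ∘ cong suc ]′ ∘ to (ind i j))
      (from (ind i j) ∘ [ inj₁ ∘ ℕ.suc-injective , inj₂ ∘ ℕ.suc-injective ]′)

    -- Induced paths ending in t all of whose other vertices lie in W.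
    data IPath (W : Fin n → Set) (t : Fin n) : Fin n → List (Fin n) → Set where
      end  : IPath W t t []
      cons : ∀ {a b p} → W a → Adj G a b → All (Far a) p → IPath W t b p → IPath W t a (b ∷ p)

    module _ {W : Fin n → Set} {t : Fin n} where

      -- Keep the path from its last vertex near `a` onwards: either that vertex is `a` itself, or
      -- it is a neighbour of `a` and everything after it is far from `a`.
      cut : ∀ {a b p} → IPath W t b p → Any (Near a) (b ∷ p) →
            (∃[ p′ ] IPath W t a p′) ⊎
            (∃[ b′ ] ∃[ p′ ] IPath W t b′ p′ × Adj G a b′ × All (Far a) p′)
      cut end (here (inj₁ at))   = inj₂ (_ , _ , end , at , [])
      cut end (here (inj₂ refl)) = inj₁ (_ , end)
      cut {a} ip@(cons {b = b} {p} _ _ _ ip′) near with Any.any? (Near? a) (b ∷ p)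
      ... | yes near′ = cut ip′ near′
      cut {a} ip (here (inj₁ ab))   | no far = inj₂ (_ , _ , ip , ab , All.¬Any⇒All¬ _ far)
      cut {a} ip (here (inj₂ refl)) | no far = inj₁ (_ , ip)
      cut {a} ip (there near)       | no far = contradiction near far

      extend : ∀ {a b p} → IPath W t b p → W a → Adj G a b → ∃[ p′ ] IPath W t a p′
      extend ip Wa ab with cut ip (here (inj₁ ab))
      ... | inj₁ r = r
      ... | inj₂ (_ , _ , ip′ , ab′ , far) = _ , cons Wa ab′ far ip′

      -- Cutting at each new vertex of the walk removes all chords, so any walk in `W` is shortened
      -- to an induced path.
      extend-Conn : ∀ {a b p} → IPath W t b p → Conn G W b a → ∃[ p′ ] IPath W t a p′
      extend-Conn ip (here _)      = _ , ip
      extend-Conn ip (step c wa Wa) =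
        extend (proj₂ (extend-Conn ip c)) Wa (Adj-sym G wa)

      IPath-Induced : ∀ {b p} → IPath W t b p → Induced (b ∷ p)
      IPath-Induced end                = Induced-[ _ ]
      IPath-Induced (cons _ ab far ip) = Induced-∷ ab far (IPath-Induced ip)

      ≢-∷ : ∀ {a b p} → Adj G a b → All (Far a) p → ∀ i → a ≢ List.lookup (b ∷ p) i
      ≢-∷ ab far zero    refl = ¬Adj-refl G ab
      ≢-∷ ab far (suc i) e    = lookup-All far i (inj₂ e)

      IPath-Inj : ∀ {b p} → IPath W t b p → Inj (b ∷ p)
      IPath-Inj end {zero} {zero} _  = refl
      IPath-Inj (cons _ ab far ip) = Inj-∷ (≢-∷ ab far) (IPath-Inj ip)

      module _ {x : Fin n} (xt : Adj G x t) (x≁W : ∀ {u} → W u → x ≢ u × ¬ Adj G x u) where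

        IPath-x : ∀ {b p} → IPath W t b p → ∀ i →
                  Adj G x (List.lookup (b ∷ p) i) ⇔ suc (toℕ i) ≡ length (b ∷ p)
        IPath-x end zero = mk⇔ (λ _ → refl) (λ _ → xt)
        IPath-x (cons Wa _ _ _)  zero    = mk⇔ (λ xa → contradiction xa (proj₂ (x≁W Wa))) λ ()
        IPath-x (cons _ _ _ ip)  (suc i) = mk⇔ (cong suc ∘ to (IPath-x ip i)) (from (IPath-x ip i) ∘ ℕ.suc-injective)

        x≢IPath : ∀ {b p} → IPath W t b p → ∀ i → x ≢ List.lookup (b ∷ p) i
        x≢IPath end             zero refl = ¬Adj-refl G xt
        x≢IPath (cons Wa _ _ _) zero e    = proj₁ (x≁W Wa) e
        x≢IPath (cons _ _ _ ip) (suc i)   = x≢IPath ip i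

        -- The cycle runs from `x` to `s`, along the path to `t`, and back to `x`. As `s` and `t`
        -- are not adjacent, the path has at least two vertices, which gives length at least 4.
        induced-cycle : ∀ {s b p} → Adj G x s → s ≢ t → ¬ Adj G s t →
                        IPath W t b p → Adj G s b → All (Far s) p → ¬ Chordal G
        induced-cycle xs s≢t s≁t end sb far chordal = s≁t sb
        induced-cycle {s} {b} {b′ ∷ p} xs s≢t s≁t ip@(cons Wb _ _ _) sb far chordal =
          chordal m (s≤s (s≤s (s≤s (s≤s z≤n)))) (List.lookup (x ∷ q)) (inj , adj⇔)
          where
          q : List (Fin n)
          q = s ∷ b ∷ b′ ∷ p
          m : ℕ
          m = suc (length q)
          x≢q : ∀ i → x ≢ List.lookup q i
          x≢q zero refl = ¬Adj-refl G xs
          x≢q (suc i)   = x≢IPath ip i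
          inj : Inj (x ∷ q)
          inj = Inj-∷ x≢q (Inj-∷ (≢-∷ sb far) (IPath-Inj ip))
          xq : ∀ i → Adj G x (List.lookup q i) ⇔ (toℕ i ≡ 0 ⊎ suc (toℕ i) ≡ length q)
          xq zero    = mk⇔ (λ _ → inj₁ refl) (λ _ → xs)
          xq (suc i) = mk⇔ (inj₂ ∘ cong suc ∘ to (IPath-x ip i))
            λ { (inj₂ e) → from (IPath-x ip i) (ℕ.suc-injective e) }
          q-ind : Induced q
          q-ind = Induced-∷ sb far (IPath-Induced ip)
          x-adj⇔ : ∀ j → Adj G x (List.lookup q j) ⇔ CycAdj m zero (suc j)
          x-adj⇔ j = mk⇔
            ([ inj₁ ∘ inj₁ ∘ cong suc , (λ e → inj₂ (inj₂ (cong suc e , refl))) ]′ ∘ to (xq j))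
            λ { (inj₁ (inj₁ e)) → from (xq j) (inj₁ (ℕ.suc-injective e))
              ; (inj₁ (inj₂ ()))
              ; (inj₂ (inj₁ ()))
              ; (inj₂ (inj₂ (e , _))) → from (xq j) (inj₂ (ℕ.suc-injective e)) }
          swap⊎ : ∀ {A B : Set} → A ⊎ B → B ⊎ A
          swap⊎ = [ inj₂ , inj₁ ]′
          adj⇔ : ∀ i j → Adj G (List.lookup (x ∷ q) i) (List.lookup (x ∷ q) j) ⇔ CycAdj m i j
          adj⇔ zero zero = mk⇔ (⊥-elim ∘ ¬Adj-refl G)
            λ { (inj₁ (inj₁ ())) ; (inj₁ (inj₂ ())) ; (inj₂ (inj₁ ())) ; (inj₂ (inj₂ ())) }
          adj⇔ zero (suc j) = x-adj⇔ j
          adj⇔ (suc j) zero = mk⇔ (swap⊎ ∘ to (x-adj⇔ j) ∘ Adj-sym G)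
                                  (Adj-sym G ∘ from (x-adj⇔ j) ∘ swap⊎)
          adj⇔ (suc i) (suc j) = mk⇔
            ([ inj₁ ∘ inj₁ ∘ cong suc , inj₂ ∘ inj₁ ∘ cong suc ]′ ∘ to (q-ind i j))
            λ { (inj₁ (inj₁ e)) → from (q-ind i j) (inj₁ (ℕ.suc-injective e))
              ; (inj₁ (inj₂ ()))
              ; (inj₂ (inj₁ e)) → from (q-ind i j) (inj₂ (ℕ.suc-injective e))
              ; (inj₂ (inj₂ ())) }

  -- Otherwise an induced path from `s` to `t` with its inner vertices in `W`, closed up by `x`,
  -- would be a long induced cycle.
  attachments-adjacent : Chordal G → ∀ {W : Fin n → Set} {x s t} →
    (∀ {u} → W u → x ≢ u × ¬ Adj G x u) → Adj G x s → Adj G x t → s ≢ t →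
    ∀ {c d} → Conn G W c d → Adj G c t → Adj G d s → Adj G s t
  attachments-adjacent chordal {W} {x} {s} {t} x≁W xs xt s≢t {c} {d} cd ct ds with Adj? s t
  ... | yes st = st
  ... | no s≁t with extend-Conn (cons (Conn-start cd) ct [] end) cd
  ...   | _ , ip with cut ip (here (inj₁ (Adj-sym G ds)))
  ...     | inj₂ (_ , _ , ip′ , sb , far) = ⊥-elim (induced-cycle xt x≁W xs s≢t s≁t ip′ sb far chordal)
  -- `s` cannot lie on the path itself: the end of the path is `t`, and its other vertices are in
  -- `W`, hence not adjacent to `x`.
  ...     | inj₁ (_ , end) = contradiction refl s≢t
  ...     | inj₁ (_ , cons Ws _ _ _) = contradiction xs (proj₂ (x≁W Ws))

  -- Colouring `W` with `zero` and its complement with another colour turns components of `W` into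
  -- Kempe chains, whose membership is already decided.
  Conn? : ∀ {W : Fin n → Set} → (∀ u → Dec (W u)) → ∀ v u → Dec (Conn G W v u)
  Conn? {W} W? v u = map′ (Conn-map to-W) (Conn-map from-W) (Conn-InPair? G α zero zero v u)
    where
    colour : ∀ {A : Set} → Dec A → Fin 2
    colour (yes _) = zero
    colour (no _)  = suc zero
    α : Col n 2
    α = tabulate λ u → colour (W? u)
    to-W : ∀ {u} → InPair α zero zero u → W u
    to-W {u} (inj₂ e) = to-W (inj₁ e)
    to-W {u} (inj₁ e) rewrite lookup∘tabulate (λ u → colour (W? u)) u with W? u
    ... | yes Wu = Wu
    to-W {u} (inj₁ ()) | no _
    from-W : ∀ {u} → W u → InPair α zero zero u
    from-W {u} Wu rewrite lookup∘tabulate (λ u → colour (W? u)) u with W? u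
    ... | yes _  = inj₁ refl
    ... | no ¬Wu = contradiction Wu ¬Wu

  -- Simplicial vertices

  Simplicial : (Fin n → Bool) → Fin n → Set
  Simplicial U z = ∀ {u w} → U u ≡ true → U w ≡ true → Adj G z u → Adj G z w → u ≢ w → Adj G u w

  module _ (chordal : Chordal G) where

    -- Dirac's theorem, strengthened to make the induction work; its step passes to
    -- a component C of U minus the closed neighbourhood of x, together with the
    -- vertices S attaching it to x, which form a clique.
    universal-or-simplicial : ∀ m U → cardB U ≤ m → ∀ x → U x ≡ true →
      (∀ {u} → U u ≡ true → u ≢ x → Adj G x u) ⊎
      (∃[ z ] U z ≡ true × z ≢ x × ¬ Adj G x z × Simplicial U z)
    universal-or-simplicial zero U U≤0 x Ux =
      contradiction (cardB-< {f = λ _ → false} (λ _ ()) x Ux refl) (ℕ.≤⇒≯ (ℕ.≤-trans U≤0 z≤n))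
    universal-or-simplicial (suc m) U U≤m x Ux
      with any? (λ y → (U y Bool.≟ true) ×-dec ¬? (y ≟F x) ×-dec ¬? (Adj? x y))
    ... | no none = inj₁ universal
      where
      universal : ∀ {u} → U u ≡ true → u ≢ x → Adj G x u
      universal {u} Uu u≢x with Adj? x u
      ... | yes xu = xu
      ... | no x≁u = contradiction (u , Uu , u≢x , x≁u) none
    ... | yes (y , Wy) = inj₂ answer
      where
      W C S H : Fin n → Set
      W u = U u ≡ true × u ≢ x × ¬ Adj G x u
      C u = Conn G W y u
      S u = U u ≡ true × Adj G x u × ∃[ c ] C c × Adj G c u
      H u = C u ⊎ S u
      W? : ∀ u → Dec (W u)
      W? u = (U u Bool.≟ true) ×-dec ¬? (u ≟F x) ×-dec ¬? (Adj? x u)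
      C? : ∀ u → Dec (C u)
      C? = Conn? W? y
      S? : ∀ u → Dec (S u)
      S? u = (U u Bool.≟ true) ×-dec Adj? x u ×-dec any? (λ c → C? c ×-dec Adj? c u)
      H? : ∀ u → Dec (H u)
      H? u = C? u ⊎-dec S? u
      HB : Fin n → Bool
      HB u = does (H? u)
      HB⇒H : ∀ {u} → HB u ≡ true → H u
      HB⇒H {u} = does-true (H? u)
      H⇒HB : ∀ {u} → H u → HB u ≡ true
      H⇒HB {u} = dec-true (H? u)
      H⇒U : ∀ {u} → H u → U u ≡ true
      H⇒U (inj₁ Cu) = proj₁ (Conn-end Cu)
      H⇒U (inj₂ Su) = proj₁ Su
      ¬Hx : ¬ H x
      ¬Hx (inj₁ Cx) = proj₁ (proj₂ (Conn-end Cx)) refl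
      ¬Hx (inj₂ Sx) = ¬Adj-refl G (proj₁ (proj₂ Sx))
      -- `x` is in `U` but not in `H`, so the induction passes to a smaller set.
      HB≤m : cardB HB ≤ m
      HB≤m = ℕ.≤-pred (ℕ.≤-trans (cardB-< (λ _ → H⇒U ∘ HB⇒H) x Ux (dec-false (H? x) ¬Hx)) U≤m)
      S-clique : ∀ {s t} → S s → S t → s ≢ t → Adj G s t
      S-clique (_ , xs , d , Cd , ds) (_ , xt , c , Cc , ct) s≢t =
        attachments-adjacent chordal (λ (_ , u≢x , x≁u) → (u≢x ∘ ≡-sym) , x≁u) xs xt s≢t
          (Conn-trans (Conn-sym Cc) Cd) ct ds
      C-nbr : ∀ {z u} → C z → U u ≡ true → Adj G z u → H u
      C-nbr {z} {u} Cz Uu zu with Adj? x u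
      ... | yes xu = inj₂ (Uu , xu , z , Cz , zu)
      ... | no x≁u = inj₁ (step Cz zu (Uu , u≢x , x≁u))
        where
        u≢x : u ≢ x
        u≢x refl = proj₂ (proj₂ (Conn-end Cz)) (Adj-sym G zu)
      Answer : Set
      Answer = ∃[ z ] U z ≡ true × z ≢ x × ¬ Adj G x z × Simplicial U z
      -- By `C-nbr`, all neighbours in `U` of a vertex of `C` already lie in `H`; hence it is enough
      -- to find a simplicial vertex of `H` that belongs to `C`.
      lift : ∀ {z} → C z → Simplicial HB z → Answer
      lift {z} Cz simp with Conn-end Cz
      ... | Uz , z≢x , x≁z = z , Uz , z≢x , x≁z , λ Uu Uw zu zw →
        simp (H⇒HB (C-nbr Cz Uu zu)) (H⇒HB (C-nbr Cz Uw zw)) zu zw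
      NonNbr : Fin n → Set
      NonNbr s = ∃[ u ] H u × u ≢ s × ¬ Adj G s u
      NonNbr? : ∀ s → Dec (NonNbr s)
      NonNbr? s = any? (λ u → H? u ×-dec ¬? (u ≟F s) ×-dec ¬? (Adj? s u))
      answer : Answer
      -- The induction is useful only at a vertex with a non-neighbour in `H`. If one lies in `S`,
      -- the simplicial vertex found is not adjacent to it, so it is in `C` because `S` is a clique.
      -- Otherwise each vertex of `S` is adjacent to all the rest of `H`, and starting from some `c`
      -- in `C` again leads into `C`. If neither exists, `H` is complete and `y` will do.
      answer with any? (λ s → S? s ×-dec NonNbr? s)
      answer | yes (s , Ss , u , Hu , u≢s , s≁u)
        with universal-or-simplicial m HB HB≤m s (H⇒HB (inj₂ Ss))
      ... | inj₁ universal = contradiction (universal (H⇒HB Hu) u≢s) s≁u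
      ... | inj₂ (z , Hz , z≢s , s≁z , simp) with HB⇒H {z} Hz
      ...   | inj₁ Cz = lift Cz simp
      ...   | inj₂ Sz = contradiction (S-clique Ss Sz (z≢s ∘ ≡-sym)) s≁z
      answer | no S-universal with any? (λ c → C? c ×-dec NonNbr? c)
      answer | no S-universal | yes (c , Cc , u , Hu , u≢c , c≁u)
        with universal-or-simplicial m HB HB≤m c (H⇒HB (inj₁ Cc))
      ... | inj₁ universal = contradiction (universal (H⇒HB Hu) u≢c) c≁u
      ... | inj₂ (z , Hz , z≢c , c≁z , simp) with HB⇒H {z} Hz
      ...   | inj₁ Cz = lift Cz simp
      ...   | inj₂ Sz = contradiction
        (z , Sz , c , inj₁ Cc , (z≢c ∘ ≡-sym) , λ zc → c≁z (Adj-sym G zc)) S-universal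
      answer | no S-universal | no C-universal = lift (here Wy) λ {u} {w} HBu HBw _ _ → complete u w HBu HBw
        where
        complete : ∀ u w → HB u ≡ true → HB w ≡ true → u ≢ w → Adj G u w
        complete u w HBu HBw u≢w with Adj? u w
        ... | yes uw = uw
        ... | no u≁w with HB⇒H {u} HBu
        ...   | inj₁ Cu = contradiction (u , Cu , w , HB⇒H HBw , (u≢w ∘ ≡-sym) , u≁w) C-universal
        ...   | inj₂ Su = contradiction (u , Su , w , HB⇒H HBw , (u≢w ∘ ≡-sym) , u≁w) S-universal

    -- The alternative above gives nothing at a universal vertex, so it is applied at a vertex with
    -- a non-neighbour; if there is none, `U` is a clique.
    simplicial-exists : ∀ U {x} → U x ≡ true → ∃[ z ] U z ≡ true × Simplicial U z
    simplicial-exists U {x} Ux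
      with any? (λ s → (U s Bool.≟ true) ×-dec any? (λ u → (U u Bool.≟ true) ×-dec ¬? (u ≟F s) ×-dec ¬? (Adj? s u)))
    ... | no none = x , Ux , complete
      where
      complete : Simplicial U x
      complete {u} {w} Uu Uw _ _ u≢w with Adj? u w
      ... | yes uw = uw
      ... | no u≁w = contradiction (u , Uu , w , Uw , (u≢w ∘ ≡-sym) , u≁w) none
    ... | yes (s , Us , u , Uu , u≢s , s≁u) with universal-or-simplicial _ U ℕ.≤-refl s Us
    ...   | inj₁ universal = contradiction (universal Uu u≢s) s≁u
    ...   | inj₂ (z , Uz , _ , _ , simp) = z , Uz , simp

  -- The vertex eliminated first has the largest rank, so the clique consists of the
  -- neighbours of smaller rank.
  record PEO (U : Fin n → Bool) (m : ℕ) (r : Fin n → ℕ) : Set where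
    field
      rank<  : ∀ {u} → U u ≡ true → r u < m
      rank-injective : ∀ {u v} → U u ≡ true → U v ≡ true → r u ≡ r v → u ≡ v
      earlier-clique : ∀ {u w v} → U u ≡ true → U w ≡ true → U v ≡ true →
        r u < r v → r w < r v → Adj G v u → Adj G v w → u ≢ w → Adj G u w

  _without_ : (Fin n → Bool) → Fin n → Fin n → Bool
  (U without z) u = U u ∧ not (u ==F z)

  -- With the largest rank, `z` is an earlier neighbour of no vertex, and its own earlier neighbours
  -- form a clique because it is simplicial.
  PEO-extend : ∀ {m U z r′} → U z ≡ true → Simplicial U z → PEO (U without z) m r′ →
               PEO U (suc m) (λ u → if u ==F z then m else r′ u)
  PEO-extend {m} {U} {z} {r′} Uz simp peo′ = record
    { rank< = rank< ; rank-injective = rank-inj ; earlier-clique = clique }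
    where
    U′ : Fin n → Bool
    U′ = U without z
    module r′ = PEO peo′
    r : Fin n → ℕ
    r u = if u ==F z then m else r′ u
    U′-intro : ∀ {u} → U u ≡ true → u ≢ z → U′ u ≡ true
    U′-intro {u} Uu u≢z rewrite Uu | dec-false (u ≟F z) u≢z = refl
    r-z : r z ≡ m
    r-z rewrite dec-true (z ≟F z) refl = refl
    r-≢z : ∀ {u} → u ≢ z → r u ≡ r′ u
    r-≢z {u} u≢z rewrite dec-false (u ≟F z) u≢z = refl
    cases : ∀ u → U u ≡ true → (u ≡ z × r u ≡ m) ⊎ (U′ u ≡ true × r u ≡ r′ u × r′ u < m)
    cases u Uu = split (u ≟F z)
      where
      split : Dec (u ≡ z) → (u ≡ z × r u ≡ m) ⊎ (U′ u ≡ true × r u ≡ r′ u × r′ u < m)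
      split (yes refl) = inj₁ (refl , r-z)
      split (no u≢z) = inj₂ (U′-intro Uu u≢z , r-≢z u≢z , r′.rank< (U′-intro Uu u≢z))
    rank< : ∀ {u} → U u ≡ true → r u < suc m
    rank< {u} Uu with cases u Uu
    ... | inj₁ (_ , e) = s≤s (ℕ.≤-reflexive e)
    ... | inj₂ (_ , e , lt) = s≤s (ℕ.≤-trans (ℕ.≤-reflexive e) (ℕ.<⇒≤ lt))
    rank-inj : ∀ {u v} → U u ≡ true → U v ≡ true → r u ≡ r v → u ≡ v
    rank-inj {u} {v} Uu Uv e with cases u Uu | cases v Uv
    ... | inj₁ (refl , _) | inj₁ (refl , _) = refl
    ... | inj₁ (_ , eu)   | inj₂ (_ , ev , lt) = contradiction (trans (≡-sym ev) (trans (≡-sym e) eu)) (ℕ.<⇒≢ lt)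
    ... | inj₂ (_ , eu , lt) | inj₁ (_ , ev)   = contradiction (trans (≡-sym eu) (trans e ev)) (ℕ.<⇒≢ lt)
    ... | inj₂ (U′u , eu , _) | inj₂ (U′v , ev , _) =
      r′.rank-injective U′u U′v (trans (≡-sym eu) (trans e ev))
    clique : ∀ {u w v} → U u ≡ true → U w ≡ true → U v ≡ true →
      r u < r v → r w < r v → Adj G v u → Adj G v w → u ≢ w → Adj G u w
    clique {u} {w} {v} Uu Uw Uv u<v w<v vu vw u≢w with cases v Uv
    ... | inj₁ (refl , _) = simp Uu Uw vu vw u≢w
    ... | inj₂ (U′v , ev , v<m) with cases u Uu | cases w Uw
    ...   | inj₁ (_ , eu) | _ = contradiction (subst (_< r v) eu u<v) (ℕ.<⇒≯ (subst (_< m) (≡-sym ev) v<m))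
    ...   | inj₂ _ | inj₁ (_ , ew) = contradiction (subst (_< r v) ew w<v) (ℕ.<⇒≯ (subst (_< m) (≡-sym ev) v<m))
    ...   | inj₂ (U′u , eu , _) | inj₂ (U′w , ew , _) = r′.earlier-clique U′u U′w U′v
      (subst (_< r′ v) eu (subst (r u <_) ev u<v)) (subst (_< r′ v) ew (subst (r w <_) ev w<v)) vu vw u≢w

  PEO-exists : Chordal G → ∀ m U → cardB U ≤ m → ∃[ r ] PEO U m r
  PEO-exists chordal m U U≤m with any? (λ x → U x Bool.≟ true)
  ... | no empty = (λ _ → 0) , record
    { rank< = λ Uu → contradiction (_ , Uu) empty
    ; rank-injective = λ Uu → contradiction (_ , Uu) empty
    ; earlier-clique = λ Uu → contradiction (_ , Uu) empty }
  PEO-exists chordal zero U U≤0 | yes (x , Ux) =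
    contradiction (cardB-< {f = λ _ → false} (λ _ ()) x Ux refl) (ℕ.≤⇒≯ (ℕ.≤-trans U≤0 z≤n))
  PEO-exists chordal (suc m) U U≤m | yes (x , Ux) with simplicial-exists chordal U Ux
  ... | z , Uz , simp with PEO-exists chordal m (U without z) (ℕ.≤-pred (ℕ.≤-trans smaller U≤m))
    where
    z∉ : (U without z) z ≡ false
    z∉ rewrite dec-true (z ≟F z) refl = Bool.∧-zeroʳ (U z)
    smaller : cardB (U without z) < cardB U
    smaller = cardB-< (λ u e → proj₁ (∧-true (U u) e)) z Uz z∉
  ... | r′ , peo′ = _ , PEO-extend Uz simp peo′

-- Kempe exchanges and moves

module _ {k : ℕ} where

  swapCol-left : ∀ (a b : Fin k) → swapCol a b a ≡ b
  swapCol-left a b rewrite dec-true (a ≟F a) refl = refl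

  swapCol-right : ∀ (a b : Fin k) → swapCol a b b ≡ a
  swapCol-right a b with b ≟F a
  ... | yes b≡a = b≡a
  ... | no _ rewrite dec-true (b ≟F b) refl = refl

  swapCol-other : ∀ {a b c : Fin k} → c ≢ a → c ≢ b → swapCol a b c ≡ c
  swapCol-other {a} {b} {c} c≢a c≢b rewrite dec-false (c ≟F a) c≢a | dec-false (c ≟F b) c≢b = refl

  swapCol-∈ : ∀ {a b c : Fin k} → c ≡ a ⊎ c ≡ b → swapCol a b c ≡ a ⊎ swapCol a b c ≡ b
  swapCol-∈ {a} {b} (inj₁ refl) = inj₂ (swapCol-left a b)
  swapCol-∈ {a} {b} (inj₂ refl) = inj₁ (swapCol-right a b)

  private
    swapCol-elim : ∀ (Q : Fin k → Set) {a b} → Q a → Q b → (∀ {c} → c ≢ a → c ≢ b → Q c) → ∀ c → Q c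
    swapCol-elim Q {a} {b} qa qb qc c with c ≟F a | c ≟F b
    ... | yes refl | _        = qa
    ... | no _     | yes refl = qb
    ... | no c≢a   | no c≢b   = qc c≢a c≢b

  swapCol-involutive : ∀ a b (c : Fin k) → swapCol a b (swapCol a b c) ≡ c
  swapCol-involutive a b = swapCol-elim (λ c → swapCol a b (swapCol a b c) ≡ c)
    (trans (cong (swapCol a b) (swapCol-left a b)) (swapCol-right a b))
    (trans (cong (swapCol a b) (swapCol-right a b)) (swapCol-left a b))
    (λ c≢a c≢b → trans (cong (swapCol a b) (swapCol-other c≢a c≢b)) (swapCol-other c≢a c≢b))

  swapCol-comm : ∀ a b (c : Fin k) → swapCol a b c ≡ swapCol b a c
  swapCol-comm a b = swapCol-elim (λ c → swapCol a b c ≡ swapCol b a c)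
    (trans (swapCol-left a b) (≡-sym (swapCol-right b a)))
    (trans (swapCol-right a b) (≡-sym (swapCol-left b a)))
    (λ c≢a c≢b → trans (swapCol-other c≢a c≢b) (≡-sym (swapCol-other c≢b c≢a)))

  swapCol-injective : ∀ a b {c d : Fin k} → swapCol a b c ≡ swapCol a b d → c ≡ d
  swapCol-injective a b {c} {d} e =
    trans (≡-sym (swapCol-involutive a b c)) (trans (cong (swapCol a b) e) (swapCol-involutive a b d))

  swapCol-same : ∀ (a c : Fin k) → swapCol a a c ≡ c
  swapCol-same a = swapCol-elim (λ c → swapCol a a c ≡ c) (swapCol-left a a) (swapCol-left a a) swapCol-other

lookup-ext : ∀ {A : Set} {n} {xs ys : Vec A n} → (∀ i → lookup xs i ≡ lookup ys i) → xs ≡ ys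
lookup-ext {xs = xs} {ys} e =
  trans (≡-sym (tabulate∘lookup xs)) (trans (tabulate-cong e) (tabulate∘lookup ys))

module _ {n k : ℕ} (G : Graph n) where

  Chain : Col n k → Fin k → Fin k → Fin n → Fin n → Set
  Chain α a b v u = Conn G (InPair α a b) v u

  module _ (α : Col n k) (a b : Fin k) (v : Fin n) where

    exchange-on : ∀ {u} → Chain α a b v u → lookup (kempeExchange G α a b v) u ≡ swapCol a b (lookup α u)
    exchange-on {u} c rewrite lookup∘tabulate (λ u → if kempeChain G α a b v u then swapCol a b (lookup α u) else lookup α u) u
                            | kempeChain-complete G α a b v c = refl

    exchange-off : ∀ {u} → ¬ Chain α a b v u → lookup (kempeExchange G α a b v) u ≡ lookup α u
    exchange-off {u} ¬c rewrite lookup∘tabulate (λ u → if kempeChain G α a b v u then swapCol a b (lookup α u) else lookup α u) u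
                              | Bool.¬-not {kempeChain G α a b v u} (¬c ∘ kempeChain-sound G α a b v) = refl

  exchange-unique : ∀ {α β : Col n k} {a b v} →
    (∀ {u} → Chain α a b v u → swapCol a b (lookup α u) ≡ lookup β u) →
    (∀ {u} → ¬ Chain α a b v u → lookup α u ≡ lookup β u) →
    kempeExchange G α a b v ≡ β
  exchange-unique {α} {β} {a} {b} {v} on off = lookup-ext pointwise
    where
    pointwise : ∀ u → lookup (kempeExchange G α a b v) u ≡ lookup β u
    pointwise u with Conn-InPair? G α a b v u
    ... | yes c = trans (exchange-on α a b v c) (on c)
    ... | no ¬c = trans (exchange-off α a b v ¬c) (off ¬c)

  exchange-same : ∀ (α : Col n k) a v → kempeExchange G α a a v ≡ α
  exchange-same α a v = exchange-unique (λ _ → swapCol-same a _) (λ _ → refl)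

  exchange-empty : ∀ (α : Col n k) {a b v} → ¬ InPair α a b v → kempeExchange G α a b v ≡ α
  exchange-empty α ¬v = exchange-unique (λ c → contradiction (Conn-start c) ¬v) (λ _ → refl)

  exchange-comm : ∀ (α : Col n k) a b v → kempeExchange G α a b v ≡ kempeExchange G α b a v
  exchange-comm α a b v = exchange-unique
    (λ c → trans (swapCol-comm a b (lookup α _)) (≡-sym (exchange-on α b a v (Conn-map [ inj₂ , inj₁ ]′ c))))
    (λ ¬c → ≡-sym (exchange-off α b a v (¬c ∘ Conn-map [ inj₂ , inj₁ ]′)))

  exchange-shift : ∀ (α : Col n k) a b {v w} → Chain α a b v w →
                   kempeExchange G α a b v ≡ kempeExchange G α a b w
  exchange-shift α a b {v} {w} vw = exchange-unique
    (λ c → ≡-sym (exchange-on α a b w (Conn-trans (Conn-sym vw) c)))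
    (λ ¬c → ≡-sym (exchange-off α a b w (¬c ∘ Conn-trans vw)))

  module _ (α : Col n k) (a b : Fin k) (v : Fin n) where

    private
      β : Col n k
      β = kempeExchange G α a b v

    -- An exchange permutes the two colours on its chain, so the set of vertices coloured `a` or `b`
    -- is the same before and after, and with it the chains. Involutivity and properness rest on
    -- this.
    exchange-InPair : ∀ {u} → InPair α a b u → InPair β a b u
    exchange-InPair {u} p with Conn-InPair? G α a b v u
    ... | yes c rewrite exchange-on α a b v c = swapCol-∈ p
    ... | no ¬c rewrite exchange-off α a b v ¬c = p

    exchange-InPair⁻ : ∀ {u} → InPair β a b u → InPair α a b u
    exchange-InPair⁻ {u} p with Conn-InPair? G α a b v u
    ... | yes c = Conn-end c
    ... | no ¬c rewrite exchange-off α a b v ¬c = p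

    exchange-involutive : kempeExchange G β a b v ≡ α
    exchange-involutive = exchange-unique
      (λ c → trans (cong (swapCol a b) (exchange-on α a b v (Conn-map exchange-InPair⁻ c)))
                   (swapCol-involutive a b _))
      (λ ¬c → exchange-off α a b v (¬c ∘ Conn-map exchange-InPair))

    exchange-proper : IsProper G α → IsProper G β
    exchange-proper proper u w uw e with Conn-InPair? G α a b v u | Conn-InPair? G α a b v w
    ... | yes cu | yes cw rewrite exchange-on α a b v cu | exchange-on α a b v cw =
      proper u w uw (swapCol-injective a b e)
    ... | no ¬cu | no ¬cw rewrite exchange-off α a b v ¬cu | exchange-off α a b v ¬cw =
      proper u w uw e
    -- Along an edge leaving the chain, equal new colours would mean that the outer endpoint has
    -- colour `a` or `b`, and so belongs to the chain.
    ... | yes cu | no ¬cw = ¬cw (step cu uw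
      (exchange-InPair⁻ (subst (λ c → c ≡ a ⊎ c ≡ b) e (exchange-InPair (Conn-end cu)))))
    ... | no ¬cu | yes cw = ¬cu (step cw (Adj-sym G uw)
      (exchange-InPair⁻ (subst (λ c → c ≡ a ⊎ c ≡ b) (≡-sym e) (exchange-InPair (Conn-end cw)))))

  KempeAdj : Col n k → Col n k → Set
  KempeAdj α β = α ≢ β × ∃[ v ] ∃[ a ] ∃[ b ] kempeExchange G α a b v ≡ β

  ==C-true : ∀ {α β : Col n k} → (α ==C β) ≡ true → α ≡ β
  ==C-true {α} {β} = does-true (≡-decV _≟F_ α β)

  kempeAdjB-sound : ∀ α β → kempeAdjB G α β ≡ true → KempeAdj α β
  kempeAdjB-sound α β e with ∧-true (not (α ==C β)) e
  ... | α≠β , e₁ with anyFin-true _ e₁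
  ... | v , e₂ with anyFin-true _ e₂
  ... | a , e₃ with anyFin-true _ e₃
  ... | b , e₄ = (λ { refl → true≢false α≠β (cong not (dec-true (≡-decV _≟F_ α α) refl)) })
               , v , a , b , ==C-true e₄

  kempeAdjB-complete : ∀ α β → KempeAdj α β → kempeAdjB G α β ≡ true
  kempeAdjB-complete α β (α≢β , v , a , b , e) = cong₂ _∧_
    (cong not (dec-false (≡-decV _≟F_ α β) α≢β))
    (anyFin-intro _ v (anyFin-intro _ a (anyFin-intro _ b (dec-true (≡-decV _≟F_ _ β) e))))

  KempeAdj-sym : ∀ {α β} → KempeAdj α β → KempeAdj β α
  KempeAdj-sym {α} (α≢β , v , a , b , refl) = (α≢β ∘ ≡-sym) , v , a , b , exchange-involutive α a b v

  kempeAdjB-sym : ∀ α β → kempeAdjB G α β ≡ kempeAdjB G β α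
  kempeAdjB-sym α β = iff
    (kempeAdjB-complete β α ∘ KempeAdj-sym ∘ kempeAdjB-sound α β)
    (kempeAdjB-complete α β ∘ KempeAdj-sym ∘ kempeAdjB-sound β α)
    where
    iff : ∀ {x y} → (x ≡ true → y ≡ true) → (y ≡ true → x ≡ true) → x ≡ y
    iff {true}  {true}  _ _ = refl
    iff {true}  {false} f _ = ≡-sym (f refl)
    iff {false} {true}  _ g = g refl
    iff {false} {false} _ _ = refl

  module Moves (r : Fin n → ℕ) (peo : PEO G (λ _ → true) n r) where

    private module peo = PEO peo

    rank-injective : ∀ {u v} → r u ≡ r v → u ≡ v
    rank-injective = peo.rank-injective refl refl

    Blocked : Col n k → Fin n → Fin k → Set
    Blocked α v c = ∃[ u ] r u < r v × Adj G v u × lookup α u ≡ c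

    Blocked? : ∀ α v c → Dec (Blocked α v c)
    Blocked? α v c = any? λ u → (r u ℕ.<? r v) ×-dec Adj? G v u ×-dec (lookup α u ≟F c)

    -- A blocked colour is one for which the chain of `v` contains an earlier neighbour, so that `v`
    -- is not its root. If `c` is the present colour of `v`, the exchange is trivial.
    move : Fin n × Fin k → Col n k → Col n k
    move (v , c) α = if does (Blocked? α v c) then α else kempeExchange G α (lookup α v) c v

    move-blocked : ∀ {α v c} → Blocked α v c → move (v , c) α ≡ α
    move-blocked {α} {v} {c} bl rewrite dec-true (Blocked? α v c) bl = refl

    move-free : ∀ {α v c} → ¬ Blocked α v c → move (v , c) α ≡ kempeExchange G α (lookup α v) c v
    move-free {α} {v} {c} ¬bl rewrite dec-false (Blocked? α v c) ¬bl = refl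

    move-proper : ∀ m {α} → IsProper G α → IsProper G (move m α)
    move-proper (v , c) {α} proper with Blocked? α v c
    ... | yes _ = proper
    ... | no _ = exchange-proper α (lookup α v) c v proper

    -- An increasing path to `u` involves no colours of vertices ranked above `u`, so it survives in
    -- any colouring that agrees up to `u`. Arbitrary chain paths lack this property.
    data Inc (α : Col n k) (a b : Fin k) (v : Fin n) : Fin n → Set where
      here : Inc α a b v v
      step : ∀ {w u} → Inc α a b v w → Adj G w u → r w < r u → InPair α a b u → Inc α a b v u

    Inc-rank : ∀ {α a b v u} → Inc α a b v u → r v ≤ r u
    Inc-rank here             = ℕ.≤-refl
    Inc-rank (step i _ w<u _) = ℕ.≤-trans (Inc-rank i) (ℕ.<⇒≤ w<u)

    Inc⇒Chain : ∀ {α a b v u} → InPair α a b v → Inc α a b v u → Chain α a b v u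
    Inc⇒Chain pv here             = here pv
    Inc⇒Chain pv (step i wu _ pu) = step (Inc⇒Chain pv i) wu pu

    InPair-other : ∀ {α : Col n k} {a b u w x} → InPair α a b u → InPair α a b w → InPair α a b x →
                   lookup α w ≢ lookup α u → lookup α x ≢ lookup α u → lookup α w ≡ lookup α x
    InPair-other _ (inj₁ ew) (inj₁ ex) _ _ = trans ew (≡-sym ex)
    InPair-other _ (inj₂ ew) (inj₂ ex) _ _ = trans ew (≡-sym ex)
    InPair-other (inj₁ eu) (inj₁ ew) (inj₂ ex) w≢u _ = contradiction (trans ew (≡-sym eu)) w≢u
    InPair-other (inj₂ eu) (inj₁ ew) (inj₂ ex) _ x≢u = contradiction (trans ex (≡-sym eu)) x≢u
    InPair-other (inj₁ eu) (inj₂ ew) (inj₁ ex) _ x≢u = contradiction (trans ex (≡-sym eu)) x≢u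
    InPair-other (inj₂ eu) (inj₂ ew) (inj₁ ex) w≢u _ = contradiction (trans ew (≡-sym eu)) w≢u

    module _ (α : Col n k) (proper : IsProper G α) {v : Fin n} {c : Fin k} (free : ¬ Blocked α v c) where

      -- An earlier neighbour x of u in the chain coincides with the predecessor w
      -- of u: both carry the colour of the pair not used by u, and two distinct
      -- earlier neighbours of u would be adjacent.
      Inc-closed : ∀ {u x} → Inc α (lookup α v) c v u → Adj G u x → InPair α (lookup α v) c x →
                   Inc α (lookup α v) c v x
      Inc-closed {u} {x} i ux px with ℕ.<-cmp (r u) (r x)
      ... | tri< u<x _ _ = step i ux u<x px
      ... | tri≈ _ e _ with rank-injective e
      ...   | refl = contradiction ux (¬Adj-refl G)
      Inc-closed {u} {x} here ux (inj₁ ex) | tri> _ _ x<u = contradiction (≡-sym ex) (proper u x ux)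
      Inc-closed {u} {x} here ux (inj₂ ex) | tri> _ _ x<u = contradiction (x , x<u , ux , ex) free
      Inc-closed {u} {x} (step {w} i wu w<u pu) ux px | tri> _ _ x<u with w ≟F x
      ... | yes refl = i
      ... | no w≢x = contradiction
        (InPair-other {α} pu (Conn-end (Inc⇒Chain (inj₁ refl) i)) px (proper w u wu) (proper u x ux ∘ ≡-sym))
        (proper w x (peo.earlier-clique refl refl refl w<u x<u (Adj-sym G wu) ux w≢x))

      Chain⇒Inc : ∀ {u} → Chain α (lookup α v) c v u → Inc α (lookup α v) c v u
      Chain⇒Inc (here _)        = here
      Chain⇒Inc (step ch wu pu) = Inc-closed (Chain⇒Inc ch) wu pu

      Chain-rank : ∀ {u} → Chain α (lookup α v) c v u → r v ≤ r u
      Chain-rank = Inc-rank ∘ Chain⇒Inc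

    move-earlier : ∀ {α} → IsProper G α → ∀ v c {u} → r u < r v → lookup (move (v , c) α) u ≡ lookup α u
    move-earlier {α} proper v c u<v with Blocked? α v c
    ... | yes _ = refl
    ... | no free = exchange-off α (lookup α v) c v λ ch → ℕ.<⇒≱ u<v (Chain-rank α proper free ch)

    move-root : ∀ {α v c} → ¬ Blocked α v c → lookup (move (v , c) α) v ≡ c
    move-root {α} {v} {c} free =
      trans (cong (λ β → lookup β v) (move-free free))
            (trans (exchange-on α (lookup α v) c v (here (inj₁ refl))) (swapCol-left (lookup α v) c))

    -- Colourings that agree on an initial segment of the ordering

    Agree : ℕ → Col n k → Col n k → Set
    Agree ℓ α β = ∀ {u} → r u < ℓ → lookup α u ≡ lookup β u

    Agree-sym : ∀ {ℓ α β} → Agree ℓ α β → Agree ℓ β α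
    Agree-sym agree u<ℓ = ≡-sym (agree u<ℓ)

    Agree-Blocked : ∀ {ℓ α β v c} → Agree ℓ α β → r v ≤ ℓ → Blocked α v c → Blocked β v c
    Agree-Blocked agree v≤ℓ (u , u<v , vu , e) =
      u , u<v , vu , trans (≡-sym (agree (ℕ.<-≤-trans u<v v≤ℓ))) e

    Agree-Inc : ∀ {ℓ α β a b v u} → Agree ℓ α β → r u < ℓ → Inc α a b v u → Inc β a b v u
    Agree-Inc agree u<ℓ here = here
    Agree-Inc {a = a} {b} agree u<ℓ (step i wu w<u pu) =
      step (Agree-Inc agree (ℕ.<-trans w<u u<ℓ) i) wu w<u
           (subst (λ c → c ≡ a ⊎ c ≡ b) (agree u<ℓ) pu)

    -- The path is first made increasing, which keeps it inside the segment of agreement; then it is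
    -- carried over to `β`.
    Agree-Chain : ∀ {ℓ} α β → IsProper G α → Agree ℓ α β → ∀ {v c u} → ¬ Blocked α v c →
                  r v < ℓ → r u < ℓ →
                  Chain α (lookup α v) c v u → Chain β (lookup β v) c v u
    Agree-Chain α β proper agree {v} {c} {u} free v<ℓ u<ℓ ch =
      Inc⇒Chain (inj₁ refl) (subst (λ a → Inc β a c v u) (agree v<ℓ)
                                   (Agree-Inc agree u<ℓ (Chain⇒Inc α proper free ch)))

    -- A root outside the segment affects only later vertices. At a root inside it, both colourings
    -- block the same colours and their chains have the same trace on the segment.
    move-Agree : ∀ {ℓ α β} → IsProper G α → IsProper G β → ∀ m → Agree ℓ α β → Agree ℓ (move m α) (move m β)
    move-Agree {ℓ} {α} {β} pα pβ (v , c) agree {u} u<ℓ with r v ℕ.<? ℓ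
    ... | no v≮ℓ = trans (move-earlier pα v c u<v) (trans (agree u<ℓ) (≡-sym (move-earlier pβ v c u<v)))
      where
      u<v : r u < r v
      u<v = ℕ.<-≤-trans u<ℓ (ℕ.≮⇒≥ v≮ℓ)
    ... | yes v<ℓ with Blocked? α v c | Blocked? β v c
    ...   | yes _  | yes _  = agree u<ℓ
    ...   | yes bl | no fr  = contradiction (Agree-Blocked {α = α} {β} agree (ℕ.<⇒≤ v<ℓ) bl) fr
    ...   | no fr  | yes bl = contradiction (Agree-Blocked {α = β} {α} (Agree-sym {α = α} {β} agree) (ℕ.<⇒≤ v<ℓ) bl) fr
    ...   | no frα | no frβ with Conn-InPair? G α (lookup α v) c v u
    ...     | yes ch = trans (exchange-on α _ c v ch) (trans
      (cong₂ (λ a d → swapCol a c d) (agree v<ℓ) (agree u<ℓ))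
      (≡-sym (exchange-on β _ c v (Agree-Chain α β pα agree frα v<ℓ u<ℓ ch))))
    ...     | no ¬ch = trans (exchange-off α _ c v ¬ch) (trans (agree u<ℓ)
      (≡-sym (exchange-off β _ c v (¬ch ∘ Agree-Chain β α pβ (Agree-sym {α = α} {β} agree) frβ v<ℓ u<ℓ))))

    -- The earlier neighbours of `v` are in the segment of agreement, so `c` is free in both
    -- colourings, and both give `v` the colour `c`.
    move-Agree-suc : ∀ {ℓ α β} → IsProper G α → IsProper G β → ∀ {v c} → Agree ℓ α β → r v ≡ ℓ →
                     ¬ Blocked α v c → Agree (suc ℓ) (move (v , c) α) (move (v , c) β)
    move-Agree-suc {ℓ} {α} {β} pα pβ {v} {c} agree v≡ℓ free {u} (s≤s u≤ℓ) with r u ℕ.≟ ℓ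
    ... | no u≢ℓ = move-Agree {ℓ} {α} {β} pα pβ (v , c) agree (ℕ.≤∧≢⇒< u≤ℓ u≢ℓ)
    ... | yes u≡ℓ with rank-injective (trans u≡ℓ (≡-sym v≡ℓ))
    ...   | refl = trans (move-root free) (≡-sym (move-root (free ∘
      Agree-Blocked {α = β} {α} (Agree-sym {α = α} {β} agree) (ℕ.≤-reflexive v≡ℓ))))

    Agree-all : ∀ {α β} → Agree n α β → α ≡ β
    Agree-all agree = lookup-ext λ u → agree (peo.rank< refl)

    -- Moves and Kempe-adjacent colourings

    move⇒KempeAdj : ∀ {m α β} → α ≢ β → move m α ≡ β → KempeAdj α β
    move⇒KempeAdj {v , c} {α} α≢β e with Blocked? α v c
    ... | yes _ = contradiction e α≢β
    ... | no _  = α≢β , v , lookup α v , c , e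

    -- Descent to the root: if `b` is blocked by an earlier neighbour `w`, then `w` is in the same
    -- chain, and the exchange can be named from `w` with the two colours interchanged. The bound
    -- `j` on the rank makes this terminate.
    exchange⇒move : ∀ {α β} j {b v} → r v < j → kempeExchange G α (lookup α v) b v ≡ β →
                    ∃[ m ] move m α ≡ β
    exchange⇒move {α} {β} (suc j) {b} {v} (s≤s v≤j) ex with Blocked? α v b
    ... | no free = (v , b) , trans (move-free free) ex
    ... | yes (w , w<v , vw , refl) = exchange⇒move j (ℕ.<-≤-trans w<v v≤j)
      (trans (exchange-comm α (lookup α w) (lookup α v) w)
             (trans (≡-sym (exchange-shift α (lookup α v) (lookup α w)
                              (step (here (inj₁ refl)) vw (inj₂ refl)))) ex))

    KempeAdj⇒move : ∀ {α β} → KempeAdj α β → ∃[ m ] move m α ≡ β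
    KempeAdj⇒move {α} (α≢β , v , a , b , ex) with lookup α v ≟F a | lookup α v ≟F b
    ... | yes refl | _        = exchange⇒move (suc (r v)) ℕ.≤-refl ex
    ... | no _     | yes refl = exchange⇒move (suc (r v)) ℕ.≤-refl (trans (exchange-comm α b a v) ex)
    ... | no v≢a   | no v≢b   =
      contradiction (trans (≡-sym (exchange-empty α [ v≢a , v≢b ]′)) ex) α≢β

    -- The root of a move is the vertex of least rank that changes colour.
    move-unique : ∀ {α β} → IsProper G α → α ≢ β → ∀ {m m′} → move m α ≡ β → move m′ α ≡ β → m ≡ m′
    move-unique {α} {β} proper α≢β {v , c} {v′ , c′} e e′ = unique
      where
      free : ∀ {v c} → move (v , c) α ≡ β → ¬ Blocked α v c
      free e bl = α≢β (trans (≡-sym (move-blocked bl)) e)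
      root : ∀ {v c} → move (v , c) α ≡ β → lookup β v ≡ c
      root {v} e = trans (cong (λ γ → lookup γ v) (≡-sym e)) (move-root (free e))
      changed : ∀ {v c} → move (v , c) α ≡ β → lookup α v ≢ lookup β v
      changed {v} {c} e same = α≢β (trans (≡-sym (exchange-same α c v)) (trans
        (cong (λ a → kempeExchange G α a c v) (≡-sym (trans same (root e))))
        (trans (≡-sym (move-free (free e))) e)))
      not-earlier : ∀ {v c v′ c′} → move (v , c) α ≡ β → move (v′ , c′) α ≡ β → ¬ r v < r v′
      not-earlier {v} {v′ = v′} {c′} e e′ v<v′ = changed e
        (trans (≡-sym (move-earlier proper v′ c′ v<v′)) (cong (λ γ → lookup γ v) e′))
      unique : (v , c) ≡ (v′ , c′)
      unique with ℕ.<-cmp (r v) (r v′)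
      ... | tri< v<v′ _ _ = contradiction v<v′ (not-earlier e e′)
      ... | tri> _ _ v′<v = contradiction v′<v (not-earlier e′ e)
      ... | tri≈ _ eq _ with rank-injective eq
      ...   | refl = cong (v ,_) (trans (≡-sym (root e)) (root e′))

-- Coupling

-- Instantiated at `ℕ` to count move sequences and at `ℚ` for probabilities. The rational instance
-- unfolds to the same `foldr` as `sumQ`, so its lemmas apply directly to `P` and `dist`.
module Sums {K : Set} (_⊕_ _⊗_ : Op₂ K) (0# 1# : K) (isSemiring : IsCommutativeSemiring _≡_ _⊕_ _⊗_ 0# 1#)
            (_≼_ : Rel K 0ℓ) (≼-refl : ∀ {x} → x ≼ x)
            (⊕-mono : ∀ {w x y z} → w ≼ x → y ≼ z → (w ⊕ y) ≼ (x ⊕ z)) where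

  private module R = IsCommutativeSemiring isSemiring

  ∑ : ∀ {A : Set} → List A → (A → K) → K
  ∑ xs f = foldr (λ x s → f x ⊕ s) 0# xs

  ⟦_⟧ : ∀ {P : Set} → Dec P → K
  ⟦ d ⟧ = if does d then 1# else 0#

  module _ {A : Set} where

    ∑-cong-∈ : ∀ xs {f g : A → K} → (∀ {x} → x ∈ₗ xs → f x ≡ g x) → ∑ xs f ≡ ∑ xs g
    ∑-cong-∈ []       eq = refl
    ∑-cong-∈ (x ∷ xs) eq = cong₂ _⊕_ (eq (here refl)) (∑-cong-∈ xs (eq ∘ there))

    ∑-cong : ∀ xs {f g : A → K} → (∀ x → f x ≡ g x) → ∑ xs f ≡ ∑ xs g
    ∑-cong xs eq = ∑-cong-∈ xs (λ {x} _ → eq x)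

    ∑-mono-∈ : ∀ xs {f g : A → K} → (∀ {x} → x ∈ₗ xs → f x ≼ g x) → ∑ xs f ≼ ∑ xs g
    ∑-mono-∈ []       le = ≼-refl
    ∑-mono-∈ (x ∷ xs) le = ⊕-mono (le (here refl)) (∑-mono-∈ xs (le ∘ there))

    ∑-zero : ∀ (xs : List A) → ∑ xs (λ _ → 0#) ≡ 0#
    ∑-zero []       = refl
    ∑-zero (x ∷ xs) = trans (R.+-identityˡ _) (∑-zero xs)

    ∑-+ : ∀ xs (f g : A → K) → ∑ xs (λ x → f x ⊕ g x) ≡ ∑ xs f ⊕ ∑ xs g
    ∑-+ []       f g = ≡-sym (R.+-identityˡ 0#)
    ∑-+ (x ∷ xs) f g = begin
      (f x ⊕ g x) ⊕ ∑ xs (λ x → f x ⊕ g x)  ≡⟨ cong ((f x ⊕ g x) ⊕_) (∑-+ xs f g) ⟩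
      (f x ⊕ g x) ⊕ (∑ xs f ⊕ ∑ xs g)       ≡⟨ R.+-assoc _ _ _ ⟩
      f x ⊕ (g x ⊕ (∑ xs f ⊕ ∑ xs g))       ≡⟨ cong (f x ⊕_) (R.+-assoc _ _ _) ⟨
      f x ⊕ ((g x ⊕ ∑ xs f) ⊕ ∑ xs g)       ≡⟨ cong (λ z → f x ⊕ (z ⊕ ∑ xs g)) (R.+-comm _ _) ⟩
      f x ⊕ ((∑ xs f ⊕ g x) ⊕ ∑ xs g)       ≡⟨ cong (f x ⊕_) (R.+-assoc _ _ _) ⟩
      f x ⊕ (∑ xs f ⊕ (g x ⊕ ∑ xs g))       ≡⟨ R.+-assoc _ _ _ ⟨
      (f x ⊕ ∑ xs f) ⊕ (g x ⊕ ∑ xs g)       ∎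
      where open ≡-Reasoning

    ∑-*ˡ : ∀ c xs (f : A → K) → ∑ xs (λ x → c ⊗ f x) ≡ c ⊗ ∑ xs f
    ∑-*ˡ c []       f = ≡-sym (R.zeroʳ c)
    ∑-*ˡ c (x ∷ xs) f = trans (cong ((c ⊗ f x) ⊕_) (∑-*ˡ c xs f)) (≡-sym (R.distribˡ c (f x) (∑ xs f)))

    ∑-*ʳ : ∀ c xs (f : A → K) → ∑ xs (λ x → f x ⊗ c) ≡ ∑ xs f ⊗ c
    ∑-*ʳ c xs f = trans (∑-cong xs λ x → R.*-comm (f x) c) (trans (∑-*ˡ c xs f) (R.*-comm c _))

    ∑-single : ∀ {xs} → Unique xs → ∀ {a} → a ∈ₗ xs → ∀ {f : A → K} →
               (∀ {x} → x ≢ a → f x ≡ 0#) → ∑ xs f ≡ f a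
    ∑-single {x ∷ xs} (x∉xs ∷ _) (here refl) {f} f≡0 = begin
      f x ⊕ ∑ xs f          ≡⟨ cong (f x ⊕_) (∑-cong-∈ xs λ y∈xs → f≡0 (All.lookup x∉xs y∈xs ∘ ≡-sym)) ⟩
      f x ⊕ ∑ xs (λ _ → 0#) ≡⟨ cong (f x ⊕_) (∑-zero xs) ⟩
      f x ⊕ 0#              ≡⟨ R.+-identityʳ (f x) ⟩
      f x                   ∎
      where open ≡-Reasoning
    ∑-single {x ∷ xs} (x∉xs ∷ u) (there a∈xs) {f} f≡0 =
      trans (cong₂ _⊕_ (f≡0 (All.lookup x∉xs a∈xs)) (∑-single u a∈xs f≡0)) (R.+-identityˡ _)

    ∑-map : ∀ {B : Set} (h : B → A) ys (f : A → K) → ∑ (map h ys) f ≡ ∑ ys (f ∘ h)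
    ∑-map h []       f = refl
    ∑-map h (y ∷ ys) f = cong (f (h y) ⊕_) (∑-map h ys f)

    ∑-++ : ∀ xs ys (f : A → K) → ∑ (xs ++ ys) f ≡ ∑ xs f ⊕ ∑ ys f
    ∑-++ []       ys f = ≡-sym (R.+-identityˡ _)
    ∑-++ (x ∷ xs) ys f = trans (cong (f x ⊕_) (∑-++ xs ys f)) (≡-sym (R.+-assoc _ _ _))

  ∑-swap : ∀ {A B : Set} xs ys (f : A → B → K) →
           ∑ xs (λ x → ∑ ys (f x)) ≡ ∑ ys (λ y → ∑ xs (λ x → f x y))
  ∑-swap []       ys f = ≡-sym (∑-zero ys)
  ∑-swap (x ∷ xs) ys f = trans (cong (∑ ys (f x) ⊕_) (∑-swap xs ys f)) (≡-sym (∑-+ ys (f x) _))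

  ∑-cartesianProduct : ∀ {A B : Set} (xs : List A) (ys : List B) (f : A × B → K) →
                       ∑ (cartesianProduct xs ys) f ≡ ∑ xs (λ x → ∑ ys (λ y → f (x , y)))
  ∑-cartesianProduct []       ys f = refl
  ∑-cartesianProduct (x ∷ xs) ys f = trans (∑-++ (map (x ,_) ys) _ f)
    (cong₂ _⊕_ (∑-map (x ,_) ys f) (∑-cartesianProduct xs ys f))

module ∑ℕ = Sums _+_ _*_ 0 1 ℕ.+-*-isCommutativeSemiring _≤_ ℕ.≤-refl ℕ.+-mono-≤
open ∑ℕ using (∑; ⟦_⟧)

∑-one : ∀ {A : Set} (xs : List A) → ∑ xs (λ _ → 1) ≡ length xs
∑-one []       = refl
∑-one (x ∷ xs) = cong suc (∑-one xs)

∑-const : ∀ {A : Set} (xs : List A) c → ∑ xs (λ _ → c) ≡ length xs * c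
∑-const xs c = trans (∑ℕ.∑-cong xs (λ _ → ≡-sym (ℕ.*-identityˡ c)))
                     (trans (∑ℕ.∑-*ʳ c xs (λ _ → 1)) (cong (_* c) (∑-one xs)))

∑-member : ∀ {A : Set} {xs} {a : A} → a ∈ₗ xs → ∀ f → f a ≤ ∑ xs f
∑-member {xs = x ∷ xs} (here refl)  f = ℕ.m≤m+n (f x) _
∑-member {xs = x ∷ xs} (there a∈xs) f = ℕ.≤-trans (∑-member a∈xs f) (ℕ.m≤n+m _ (f x))

-- The number of sequences of t random maps F m that fail to bring x and z together.
module Coupling {A Mv : Set} (_≟_ : DecidableEquality A) (moves : List Mv) (F : Mv → A → A) where

  uncoupled : ℕ → A → A → ℕ
  uncoupled zero    x z = if does (x ≟ z) then 0 else 1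
  uncoupled (suc t) x z = ∑ moves λ m → uncoupled t (F m x) (F m z)

  uncoupled-same : ∀ t x → uncoupled t x x ≡ 0
  uncoupled-same zero    x rewrite dec-true (x ≟ x) refl = refl
  uncoupled-same (suc t) x = trans (∑ℕ.∑-cong moves λ m → uncoupled-same t (F m x)) (∑ℕ.∑-zero moves)

  uncoupled≤ : ∀ t x z → uncoupled t x z ≤ length moves ^ t
  uncoupled≤ zero    x z with does (x ≟ z)
  ... | true  = z≤n
  ... | false = ℕ.≤-refl
  uncoupled≤ (suc t) x z = ℕ.≤-trans (∑ℕ.∑-mono-∈ moves λ _ → uncoupled≤ t _ _)
                                     (ℕ.≤-reflexive (∑-const moves _))

length-allFin : ∀ n → length (allFin n) ≡ n
length-allFin n = length-tabulate {n = n} id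

moves : ∀ n k → List (Fin n × Fin k)
moves n k = cartesianProduct (allFin n) (allFin k)

length-moves : ∀ n k → length (moves n k) ≡ n * k
length-moves n k = begin
  length (moves n k)                                 ≡⟨ ∑-one (moves n k) ⟨
  ∑ (moves n k) (λ _ → 1)                            ≡⟨ ∑ℕ.∑-cartesianProduct (allFin n) (allFin k) _ ⟩
  ∑ (allFin n) (λ _ → ∑ (allFin k) (λ _ → 1))        ≡⟨ ∑ℕ.∑-cong (allFin n) (λ _ → trans (∑-one (allFin k)) (length-allFin k)) ⟩
  ∑ (allFin n) (λ _ → k)                             ≡⟨ ∑-const (allFin n) k ⟩
  length (allFin n) * k                              ≡⟨ cong (_* k) (length-allFin n) ⟩
  n * k                                              ∎
  where open ≡-Reasoning

∑-indicator : ∀ {k} (a : Fin k) → ∑ (allFin k) (λ c → ⟦ a ≟F c ⟧) ≡ 1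
∑-indicator {k} a = trans
  (∑ℕ.∑-single (Unique.allFin⁺ k) (∈-allFin a) {f = λ c → ⟦ a ≟F c ⟧}
    (λ {c} c≢a → cong (if_then 1 else 0) (dec-false (a ≟F c) (c≢a ∘ ≡-sym))))
  (cong (if_then 1 else 0) (dec-true (a ≟F a) refl))

-- Free colours and the coalescence time

module _ {n k ω : ℕ} (G : Graph n) (cliques≤ : ∀ S → IsClique G S → length S ≤ ω)
         (r : Fin n → ℕ) (peo : PEO G (λ _ → true) n r) where

  open Moves {k = k} G r peo
  private module peo = PEO peo

  earlier : Fin n → List (Fin n)
  earlier v = filter (λ u → (r u ℕ.<? r v) ×-dec Adj? G v u) (allFin n)

  earlier-sound : ∀ v → All (λ u → r u < r v × Adj G v u) (earlier v)
  earlier-sound v = All.all-filter (λ u → (r u ℕ.<? r v) ×-dec Adj? G v u) (allFin n)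

  -- `v` together with its earlier neighbours is a clique; counting `v` makes the inequality strict.
  earlier-length : ∀ v → length (earlier v) < ω
  earlier-length v = cliques≤ (v ∷ earlier v)
    ( All.map (λ { (_ , vu) refl → ¬Adj-refl G vu }) (earlier-sound v) ∷ unique
    , All.map proj₂ (earlier-sound v) ∷ pairwise unique (earlier-sound v) )
    where
    unique : Unique (earlier v)
    unique = Unique.filter⁺ _ (Unique.allFin⁺ n)
    adjacent : ∀ {u us} → r u < r v × Adj G v u → All (u ≢_) us → All (λ u → r u < r v × Adj G v u) us → All (Adj G u) us
    adjacent _ [] [] = []
    adjacent e@(u<v , vu) (u≢w ∷ ≢s) ((w<v , vw) ∷ es) =
      peo.earlier-clique refl refl refl u<v w<v vu vw u≢w ∷ adjacent e ≢s es
    pairwise : ∀ {us} → Unique us → All (λ u → r u < r v × Adj G v u) us → AllPairs (Adj G) us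
    pairwise [] [] = []
    pairwise (≢s ∷ us) (e ∷ es) = adjacent e ≢s es ∷ pairwise us es

  free-count : Col n k → Fin n → ℕ
  free-count α v = ∑ (allFin k) λ c → ⟦ ¬? (Blocked? α v c) ⟧

  free-or-used : ∀ α v c → 1 ≤ ⟦ ¬? (Blocked? α v c) ⟧ + ∑ (earlier v) λ u → ⟦ lookup α u ≟F c ⟧
  free-or-used α v c with Blocked? α v c
  ... | no _ = s≤s z≤n
  ... | yes (u , u<v , vu , e) = ℕ.≤-trans
    (ℕ.≤-reflexive (≡-sym (cong (if_then 1 else 0) (dec-true (lookup α u ≟F c) e))))
    (∑-member (∈-filter⁺ (λ u → (r u ℕ.<? r v) ×-dec Adj? G v u) (∈-allFin u) (u<v , vu))
              (λ u → ⟦ lookup α u ≟F c ⟧))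

  -- Every colour is free or used by an earlier neighbour. Counting the used ones by neighbour
  -- instead of by colour gives at most one for each neighbour.
  free-count-large : ∀ α v → k < free-count α v + ω
  free-count-large α v = begin-strict
    k                                                                          ≡⟨ trans (∑-one (allFin k)) (length-allFin k) ⟨
    ∑ (allFin k) (λ _ → 1)                                                     ≤⟨ ∑ℕ.∑-mono-∈ (allFin k) (λ {c} _ → free-or-used α v c) ⟩
    ∑ (allFin k) (λ c → ⟦ ¬? (Blocked? α v c) ⟧ + ∑ (earlier v) (used c))      ≡⟨ ∑ℕ.∑-+ (allFin k) _ _ ⟩
    free-count α v + ∑ (allFin k) (λ c → ∑ (earlier v) (used c))               ≡⟨ cong (free-count α v +_) (∑ℕ.∑-swap (allFin k) (earlier v) used) ⟩
    free-count α v + ∑ (earlier v) (λ u → ∑ (allFin k) (λ c → used c u))       ≡⟨ cong (free-count α v +_) (∑ℕ.∑-cong (earlier v) λ u → ∑-indicator (lookup α u)) ⟩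
    free-count α v + ∑ (earlier v) (λ _ → 1)                                   ≡⟨ cong (free-count α v +_) (∑-one (earlier v)) ⟩
    free-count α v + length (earlier v)                                        <⟨ ℕ.+-monoʳ-< (free-count α v) (earlier-length v) ⟩
    free-count α v + ω                                                         ∎
    where
    open ℕ.≤-Reasoning
    used : Fin k → Fin n → ℕ
    used c u = ⟦ lookup α u ≟F c ⟧

  -- For `g` free colours, `ω ≤ k` forces `g ≥ 1`, and `g + ω - 1 ≤ ω * g` because
  -- `(g - 1) * (ω - 1)` is not negative.
  k≤ω*free : ω ≤ k → ∀ α v → k ≤ ω * free-count α v
  k≤ω*free ω≤k α v =
    go (free-count α v) ω≤k (ℕ.≤-trans (s≤s z≤n) (earlier-length v)) (free-count-large α v)
    where
    go : ∀ {ω} g → ω ≤ k → 0 < ω → k < g + ω → k ≤ ω * g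
    go         zero    ω≤k _       k< = contradiction (ℕ.<-≤-trans k< ω≤k) (ℕ.<-irrefl refl)
    go {suc w} (suc g) _   _ (s≤s k≤) = begin
      k                  ≤⟨ k≤ ⟩
      g + suc w          ≡⟨ ℕ.+-suc g w ⟩
      suc g + w          ≤⟨ ℕ.+-monoʳ-≤ (suc g) (ℕ.m≤m*n w (suc g)) ⟩
      suc g + w * suc g  ∎
      where open ℕ.≤-Reasoning

  open Coupling (≡-decV _≟F_) (moves n k) move

  private
    L : ℕ
    L = length (moves n k)

  L≤free : ω ≤ k → ∀ α v → L ≤ n * ω * free-count α v
  L≤free ω≤k α v = begin
    L                          ≡⟨ length-moves n k ⟩
    n * k                      ≤⟨ ℕ.*-monoʳ-≤ n (k≤ω*free ω≤k α v) ⟩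
    n * (ω * free-count α v)   ≡⟨ ℕ.*-assoc n ω _ ⟨
    n * ω * free-count α v     ∎
    where open ℕ.≤-Reasoning

  good? : ∀ (α : Col n k) v (m : Fin n × Fin k) → Dec (proj₁ m ≡ v × ¬ Blocked α v (proj₂ m))
  good? α v (w , c) = (w ≟F v) ×-dec ¬? (Blocked? α v c)

  free≤good : ∀ α v → free-count α v ≤ ∑ (moves n k) (λ m → ⟦ good? α v m ⟧)
  free≤good α v = begin
    free-count α v                                                   ≡⟨ ∑ℕ.∑-cong (allFin k) here-good ⟩
    ∑ (allFin k) (λ c → ⟦ good? α v (v , c) ⟧)                       ≤⟨ ∑-member (∈-allFin v) (λ w → ∑ (allFin k) (λ c → ⟦ good? α v (w , c) ⟧)) ⟩
    ∑ (allFin n) (λ w → ∑ (allFin k) (λ c → ⟦ good? α v (w , c) ⟧))  ≡⟨ ∑ℕ.∑-cartesianProduct (allFin n) (allFin k) _ ⟨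
    ∑ (moves n k) (λ m → ⟦ good? α v m ⟧)                            ∎
    where
    open ℕ.≤-Reasoning
    here-good : ∀ c → ⟦ ¬? (Blocked? α v c) ⟧ ≡ ⟦ good? α v (v , c) ⟧
    here-good c rewrite dec-true (v ≟F v) refl = refl

  -- Divided by `L ^ t` this reads: `t` times the probability of not having met after `t` moves is
  -- at most `n * ω * j`, where `j` counts the ranks not yet known to agree. It is Markov's
  -- inequality with `n * ω` expected moves for each rank. In the step, the extra summand
  -- `uncoupled (suc t) x z` is paid for by the good moves, each of which lowers `j` by one.
  uncoupled-bound : ω ≤ k → ∀ t j {ℓ x z} → IsProper G x → IsProper G z → ℓ + j ≡ n → Agree ℓ x z →
                    t * uncoupled t x z ≤ n * ω * L ^ t * j
  uncoupled-bound ω≤k zero j _ _ _ _ = z≤n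
  uncoupled-bound ω≤k (suc t) zero {ℓ} {x} {z} px pz ℓ≡n agree
    with Agree-all {x} {z} (subst (λ i → Agree i x z) (trans (≡-sym (ℕ.+-identityʳ ℓ)) ℓ≡n) agree)
  ... | refl rewrite uncoupled-same (suc t) x | ℕ.*-zeroʳ t = z≤n
  uncoupled-bound ω≤k (suc t) (suc j) {ℓ} {x} {z} px pz ℓ+j≡n agree
    with any? (λ v → (r v ℕ.≟ ℓ) ×-dec ¬? (lookup x v ≟F lookup z v))
  -- Nothing differs at rank `ℓ`, so the segment of agreement grows without using a move.
  ... | no none = ℕ.≤-trans
    (uncoupled-bound ω≤k (suc t) j {suc ℓ} px pz (trans (≡-sym (ℕ.+-suc ℓ j)) ℓ+j≡n) agree′)
    (ℕ.*-monoʳ-≤ (n * ω * L ^ suc t) (ℕ.n≤1+n j))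
    where
    agree′ : Agree (suc ℓ) x z
    agree′ {u} (s≤s u≤ℓ) with r u ℕ.≟ ℓ | lookup x u ≟F lookup z u
    ... | _       | yes e = e
    ... | yes u≡ℓ | no ¬e = contradiction (u , u≡ℓ , ¬e) none
    ... | no u≢ℓ  | no _  = agree (ℕ.≤∧≢⇒< u≤ℓ u≢ℓ)
  ... | yes (v , v≡ℓ , _) = begin
    suc t * uncoupled (suc t) x z        ≡⟨⟩
    uncoupled (suc t) x z + t * uncoupled (suc t) x z
      ≤⟨ ℕ.+-mono-≤ now (ℕ.≤-reflexive (≡-sym (∑ℕ.∑-*ˡ t (moves n k) (λ m → uncoupled t (move m x) (move m z))))) ⟩
    B * ∑ (moves n k) g + ∑ (moves n k) later
      ≡⟨ ℕ.+-comm (B * ∑ (moves n k) g) _ ⟩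
    ∑ (moves n k) later + B * ∑ (moves n k) g
      ≡⟨ cong (∑ (moves n k) later +_) (∑ℕ.∑-*ˡ B (moves n k) g) ⟨
    ∑ (moves n k) later + ∑ (moves n k) (λ m → B * g m)
      ≡⟨ ∑ℕ.∑-+ (moves n k) later (λ m → B * g m) ⟨
    ∑ (moves n k) (λ m → later m + B * g m)
      ≤⟨ ∑ℕ.∑-mono-∈ (moves n k) (λ {m} _ → after m) ⟩
    ∑ (moves n k) (λ _ → B * suc j)
      ≡⟨ ∑-const (moves n k) (B * suc j) ⟩
    L * (B * suc j)
      ≡⟨ solve 4 (λ l c b i → l :* ((c :* b) :* i) := (c :* (l :* b)) :* i) refl L (n * ω) (L ^ t) (suc j) ⟩
    n * ω * L ^ suc t * suc j            ∎
    where
    open ℕ.≤-Reasoning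
    open +-*-Solver using (solve; _:=_; _:*_; _:+_; con)
    B : ℕ
    B = n * ω * L ^ t
    g later : Fin n × Fin k → ℕ
    g m = ⟦ good? x v m ⟧
    later m = t * uncoupled t (move m x) (move m z)
    -- The trivial bound `L ^ suc t` suffices here: one of its factors `L` is at most `n * ω` times
    -- the number of good moves.
    now : uncoupled (suc t) x z ≤ B * ∑ (moves n k) g
    now = begin
      uncoupled (suc t) x z                   ≤⟨ uncoupled≤ (suc t) x z ⟩
      L * L ^ t                               ≤⟨ ℕ.*-monoˡ-≤ (L ^ t) (ℕ.≤-trans (L≤free ω≤k x v) (ℕ.*-monoʳ-≤ (n * ω) (free≤good x v))) ⟩
      n * ω * ∑ (moves n k) g * L ^ t         ≡⟨ solve 3 (λ c s b → c :* s :* b := c :* b :* s) refl (n * ω) (∑ (moves n k) g) (L ^ t) ⟩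
      B * ∑ (moves n k) g                     ∎
    -- A good move leaves `j` ranks instead of `suc j`, and the `B` thus saved is exactly the term
    -- `B * g m`.
    after : ∀ m → later m + B * g m ≤ B * suc j
    after (w , c) = split (good? x v (w , c))
     where
     split : (d : Dec (w ≡ v × ¬ Blocked x v c)) → later (w , c) + B * ⟦ d ⟧ ≤ B * suc j
     split (no _) = begin
      later (w , c) + B * 0  ≡⟨ trans (cong (later (w , c) +_) (ℕ.*-zeroʳ B)) (ℕ.+-identityʳ _) ⟩
      later (w , c)          ≤⟨ uncoupled-bound ω≤k t (suc j) (move-proper (w , c) px) (move-proper (w , c) pz) ℓ+j≡n
                                  (move-Agree {ℓ} {x} {z} px pz (w , c) agree) ⟩
      B * suc j              ∎
     split (yes (refl , free)) = begin
      later (w , c) + B * 1  ≤⟨ ℕ.+-monoˡ-≤ (B * 1) (uncoupled-bound ω≤k t j (move-proper (w , c) px) (move-proper (w , c) pz)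
                                  (trans (≡-sym (ℕ.+-suc ℓ j)) ℓ+j≡n) (move-Agree-suc {ℓ} {x} {z} px pz agree v≡ℓ free)) ⟩
      B * j + B * 1          ≡⟨ solve 2 (λ b i → b :* i :+ b :* con 1 := b :* (con 1 :+ i)) refl B j ⟩
      B * suc j              ∎

-- Rational arithmetic

module ∑ℚ = Sums ℚ._+_ ℚ._*_ 0ℚ 1ℚ (IsCommutativeRing.isCommutativeSemiring ℚ.+-*-isCommutativeRing)
                 ℚ._≤_ ℚ.≤-refl ℚ.+-mono-≤
open ∑ℚ using () renaming (∑ to ∑q; ⟦_⟧ to ⟦_⟧q)

-- Defined by recursion so that compatibility with sums and products is an induction; its value as a
-- fraction enters only in `inv-ι`.
ι : ℕ → ℚ
ι zero    = 0ℚ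
ι (suc n) = 1ℚ ℚ.+ ι n

ι-+ : ∀ m n → ι (m + n) ≡ ι m ℚ.+ ι n
ι-+ zero    n = ≡-sym (ℚ.+-identityˡ (ι n))
ι-+ (suc m) n = trans (cong (1ℚ ℚ.+_) (ι-+ m n)) (≡-sym (ℚ.+-assoc 1ℚ (ι m) (ι n)))

ι-* : ∀ m n → ι (m * n) ≡ ι m ℚ.* ι n
ι-* zero    n = ≡-sym (ℚ.*-zeroˡ (ι n))
ι-* (suc m) n = begin
  ι (n + m * n)                   ≡⟨ ι-+ n (m * n) ⟩
  ι n ℚ.+ ι (m * n)               ≡⟨ cong₂ ℚ._+_ (≡-sym (ℚ.*-identityˡ (ι n))) (ι-* m n) ⟩
  1ℚ ℚ.* ι n ℚ.+ ι m ℚ.* ι n      ≡⟨ ℚ.*-distribʳ-+ (ι n) 1ℚ (ι m) ⟨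
  (1ℚ ℚ.+ ι m) ℚ.* ι n            ∎
  where open ≡-Reasoning

0≤ι : ∀ n → 0ℚ ℚ.≤ ι n
0≤ι zero    = ℚ.≤-refl
0≤ι (suc n) = ℚ.+-mono-≤ {0ℚ} {1ℚ} (ℚ.<⇒≤ (ℚ.positive⁻¹ 1ℚ)) (0≤ι n)

ι-mono : ∀ {m n} → m ≤ n → ι m ℚ.≤ ι n
ι-mono {n = n} z≤n = 0≤ι n
ι-mono (s≤s m≤n)   = ℚ.+-monoʳ-≤ 1ℚ (ι-mono m≤n)

toℚᵘ-ι : ∀ n → ℚ.toℚᵘ (ι n) ℚᵘ.≃ mkℚᵘ (ℤ.+ n) 0
toℚᵘ-ι zero    = ℚᵘ.≃-refl
toℚᵘ-ι (suc n) = ℚᵘ.≃-trans (ℚ.toℚᵘ-homo-+ 1ℚ (ι n))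
  (ℚᵘ.≃-trans (ℚᵘ.+-congʳ (ℚ.toℚᵘ 1ℚ) (toℚᵘ-ι n))
              (*≡* (cong (λ i → (ℤ.+ 1 ℤ.+ i) ℤ.* ℤ.+ 1) (ℤ.*-identityʳ (ℤ.+ n)))))

inv-ι : ∀ m → inv (suc m) ℚ.* ι (suc m) ≡ 1ℚ
inv-ι m = ℚ.toℚᵘ-injective (ℚᵘ.≃-trans (ℚ.toℚᵘ-homo-* (inv (suc m)) (ι (suc m)))
  (ℚᵘ.≃-trans (ℚᵘ.*-cong (ℚ.toℚᵘ-fromℚᵘ (mkℚᵘ (ℤ.+ 1) m)) (toℚᵘ-ι (suc m)))
              (*≡* (trans (ℤ.*-identityʳ (ℤ.+ 1 ℤ.* ℤ.+ suc m)) (trans (ℤ.*-identityˡ (ℤ.+ suc m))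
                 (≡-sym (trans (ℤ.*-identityˡ (ℤ.+ (suc m * 1))) (cong ℤ.+_ (ℕ.*-identityʳ (suc m))))))))))

0≤inv : ∀ m → 0ℚ ℚ.≤ inv m
0≤inv zero    = ℚ.≤-refl
0≤inv (suc m) = ℚ.nonNegative⁻¹ (inv (suc m)) ⦃ ℚ.normalize-nonNeg 1 (suc m) ⦄

-- Random maps and total variation

module _ {X B : Set} {a b : B} where

  if-yes : (d : Dec X) → X → (if does d then a else b) ≡ a
  if-yes d x = cong (if_then a else b) (dec-true d x)

  if-no : (d : Dec X) → ¬ X → (if does d then a else b) ≡ b
  if-no d ¬x = cong (if_then a else b) (dec-false d ¬x)

if-cong-else : {X B : Set} {a b b′ : B} (d : Dec X) → (¬ X → b ≡ b′) →
               (if does d then a else b) ≡ (if does d then a else b′)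
if-cong-else (yes _) _  = refl
if-cong-else (no ¬x) eq = eq ¬x

*-monoˡ-0≤ : ∀ {c p q} → 0ℚ ℚ.≤ c → p ℚ.≤ q → c ℚ.* p ℚ.≤ c ℚ.* q
*-monoˡ-0≤ {c} 0≤c = ℚ.*-monoˡ-≤-nonNeg c ⦃ ℚ.nonNegative 0≤c ⦄

*-0≤ : ∀ {c p} → 0ℚ ℚ.≤ c → 0ℚ ℚ.≤ p → 0ℚ ℚ.≤ c ℚ.* p
*-0≤ {c} {p} 0≤c 0≤p = subst (ℚ._≤ c ℚ.* p) (ℚ.*-zeroʳ c) (*-monoˡ-0≤ 0≤c 0≤p)

∣*∣-0≤ : ∀ {c} → 0ℚ ℚ.≤ c → ∀ p → ∣ c ℚ.* p ∣ ≡ c ℚ.* ∣ p ∣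
∣*∣-0≤ {c} 0≤c p = trans (ℚ.∣p*q∣≡∣p∣*∣q∣ c p) (cong (ℚ._* ∣ p ∣) (ℚ.0≤p⇒∣p∣≡p 0≤c))

*-distribˡ-minus : ∀ c p q → c ℚ.* (p ℚ.- q) ≡ c ℚ.* p ℚ.- c ℚ.* q
*-distribˡ-minus c p q = trans (ℚ.*-distribˡ-+ c p (ℚ.- q))
                               (cong (c ℚ.* p ℚ.+_) (≡-sym (ℚ.neg-distribʳ-* c q)))

module _ {A : Set} where

  ∑q-minus : ∀ (xs : List A) f g → ∑q xs (λ x → f x ℚ.- g x) ≡ ∑q xs f ℚ.- ∑q xs g
  ∑q-minus xs f g = trans (∑ℚ.∑-+ xs f (λ x → ℚ.- g x)) (cong (∑q xs f ℚ.+_) (neg xs))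
    where
    neg : ∀ xs → ∑q xs (λ x → ℚ.- g x) ≡ ℚ.- ∑q xs g
    neg []       = refl
    neg (x ∷ xs) = trans (cong (ℚ.- g x ℚ.+_) (neg xs)) (≡-sym (ℚ.neg-distrib-+ (g x) (∑q xs g)))

  ∑q-∣∣ : ∀ (xs : List A) f → ∣ ∑q xs f ∣ ℚ.≤ ∑q xs (λ x → ∣ f x ∣)
  ∑q-∣∣ []       f = ℚ.≤-refl
  ∑q-∣∣ (x ∷ xs) f = ℚ.≤-trans (ℚ.∣p+q∣≤∣p∣+∣q∣ (f x) (∑q xs f)) (ℚ.+-monoʳ-≤ ∣ f x ∣ (∑q-∣∣ xs f))

  ∑q-const : ∀ (xs : List A) c → ∑q xs (λ _ → c) ≡ ι (length xs) ℚ.* c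
  ∑q-const []       c = ≡-sym (ℚ.*-zeroˡ c)
  ∑q-const (x ∷ xs) c = begin
    c ℚ.+ ∑q xs (λ _ → c)                  ≡⟨ cong₂ ℚ._+_ (≡-sym (ℚ.*-identityˡ c)) (∑q-const xs c) ⟩
    1ℚ ℚ.* c ℚ.+ ι (length xs) ℚ.* c       ≡⟨ ℚ.*-distribʳ-+ c 1ℚ (ι (length xs)) ⟨
    (1ℚ ℚ.+ ι (length xs)) ℚ.* c           ∎
    where open ≡-Reasoning

  ι-∑ : ∀ (xs : List A) f → ι (∑ℕ.∑ xs f) ≡ ∑q xs (ι ∘ f)
  ι-∑ []       f = refl
  ι-∑ (x ∷ xs) f = trans (ι-+ (f x) _) (cong (ι (f x) ℚ.+_) (ι-∑ xs f))

2ℚ : ℚ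
2ℚ = 1ℚ ℚ.+ 1ℚ

module RandomMaps {A Mv : Set} (_≟_ : DecidableEquality A)
  (Ω : List A) (Ω-unique : Unique Ω) (moves : List Mv) (F : Mv → A → A)
  (F-closed : ∀ m {x} → x ∈ₗ Ω → F m x ∈ₗ Ω)
  (w : ℚ) (0≤w : 0ℚ ℚ.≤ w) (w-inv : w ℚ.* ι (length moves) ≡ 1ℚ) where

  open Coupling _≟_ moves F

  kernel : A → A → ℚ
  kernel x y = w ℚ.* ∑q moves λ m → ⟦ F m x ≟ y ⟧q

  -- Splits off the first map, as `uncoupled` does, so that the coupling estimate is a direct
  -- induction. `dist` splits off the last step; `walk-last` reconciles the two.
  walk : ℕ → A → A → ℚ
  walk zero    x y = ⟦ x ≟ y ⟧q
  walk (suc t) x y = w ℚ.* ∑q moves λ m → walk t (F m x) y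

  ∑-δ : ∀ {x} → x ∈ₗ Ω → ∀ (f : A → ℚ) → ∑q Ω (λ y → ⟦ x ≟ y ⟧q ℚ.* f y) ≡ f x
  ∑-δ {x} x∈Ω f = trans
    (∑ℚ.∑-single Ω-unique x∈Ω {f = λ y → ⟦ x ≟ y ⟧q ℚ.* f y} λ {y} y≢x →
      trans (cong (ℚ._* f y) (if-no (x ≟ y) (y≢x ∘ ≡-sym))) (ℚ.*-zeroˡ (f y)))
    (trans (cong (ℚ._* f x) (if-yes (x ≟ x) refl)) (ℚ.*-identityˡ (f x)))

  ∑-δ₁ : ∀ {x} → x ∈ₗ Ω → ∑q Ω (λ y → ⟦ x ≟ y ⟧q) ≡ 1ℚ
  ∑-δ₁ {x} x∈Ω = trans (∑ℚ.∑-cong Ω λ y → ≡-sym (ℚ.*-identityʳ ⟦ x ≟ y ⟧q)) (∑-δ x∈Ω (λ _ → 1ℚ))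

  w∑-one : w ℚ.* ∑q moves (λ _ → 1ℚ) ≡ 1ℚ
  w∑-one = trans (cong (w ℚ.*_) (trans (∑q-const moves 1ℚ) (ℚ.*-identityʳ _))) w-inv

  kernel-row : ∀ {x} → x ∈ₗ Ω → ∑q Ω (kernel x) ≡ 1ℚ
  kernel-row {x} x∈Ω = begin
    ∑q Ω (λ y → w ℚ.* ∑q moves λ m → ⟦ F m x ≟ y ⟧q)   ≡⟨ ∑ℚ.∑-*ˡ w Ω _ ⟩
    w ℚ.* ∑q Ω (λ y → ∑q moves λ m → ⟦ F m x ≟ y ⟧q)   ≡⟨ cong (w ℚ.*_) (∑ℚ.∑-swap Ω moves (λ y m → ⟦ F m x ≟ y ⟧q)) ⟩
    w ℚ.* ∑q moves (λ m → ∑q Ω λ y → ⟦ F m x ≟ y ⟧q)   ≡⟨ cong (w ℚ.*_) (∑ℚ.∑-cong moves λ m → ∑-δ₁ (F-closed m x∈Ω)) ⟩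
    w ℚ.* ∑q moves (λ _ → 1ℚ)                          ≡⟨ w∑-one ⟩
    1ℚ                                                 ∎
    where open ≡-Reasoning

  -- This is the form in which `P` defines its diagonal, so only off-diagonal entries remain to be
  -- compared.
  kernel-diagonal : ∀ {x} → x ∈ₗ Ω →
    kernel x x ≡ 1ℚ ℚ.- ∑q Ω (λ y → if does (x ≟ y) then 0ℚ else kernel x y)
  kernel-diagonal {x} x∈Ω = begin
    kernel x x                                  ≡⟨ solve 2 (λ a s → a := (a :+ s) :- s) refl (kernel x x) S ⟩
    (kernel x x ℚ.+ S) ℚ.- S                    ≡⟨ cong (ℚ._- S) split ⟨
    ∑q Ω (kernel x) ℚ.- S                       ≡⟨ cong (ℚ._- S) (kernel-row x∈Ω) ⟩
    1ℚ ℚ.- S                                    ∎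
    where
    open ≡-Reasoning
    open ℚ-Solver using (solve; _:=_; _:+_; _:-_)
    off : A → ℚ
    off y = if does (x ≟ y) then 0ℚ else kernel x y
    S : ℚ
    S = ∑q Ω off
    case : ∀ y → kernel x y ≡ ⟦ x ≟ y ⟧q ℚ.* kernel x y ℚ.+ off y
    case y with does (x ≟ y)
    ... | true  = ≡-sym (trans (ℚ.+-identityʳ _) (ℚ.*-identityˡ _))
    ... | false = ≡-sym (trans (cong (ℚ._+ kernel x y) (ℚ.*-zeroˡ (kernel x y))) (ℚ.+-identityˡ _))
    split : ∑q Ω (kernel x) ≡ kernel x x ℚ.+ S
    split = trans (∑ℚ.∑-cong Ω case)
      (trans (∑ℚ.∑-+ Ω (λ y → ⟦ x ≟ y ⟧q ℚ.* kernel x y) off) (cong (ℚ._+ S) (∑-δ x∈Ω (kernel x))))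

  walk-last : ∀ t {x} → x ∈ₗ Ω → ∀ y → walk (suc t) x y ≡ ∑q Ω (λ z → walk t x z ℚ.* kernel z y)
  walk-last zero    {x} x∈Ω y = ≡-sym (∑-δ x∈Ω (λ z → kernel z y))
  walk-last (suc t) {x} x∈Ω y = begin
    w ℚ.* ∑q moves (λ m → walk (suc t) (F m x) y)
      ≡⟨ cong (w ℚ.*_) (∑ℚ.∑-cong moves λ m → walk-last t (F-closed m x∈Ω) y) ⟩
    w ℚ.* ∑q moves (λ m → ∑q Ω λ z → walk t (F m x) z ℚ.* kernel z y)
      ≡⟨ cong (w ℚ.*_) (∑ℚ.∑-swap moves Ω (λ m z → walk t (F m x) z ℚ.* kernel z y)) ⟩
    w ℚ.* ∑q Ω (λ z → ∑q moves λ m → walk t (F m x) z ℚ.* kernel z y)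
      ≡⟨ cong (w ℚ.*_) (∑ℚ.∑-cong Ω λ z → ∑ℚ.∑-*ʳ (kernel z y) moves (λ m → walk t (F m x) z)) ⟩
    w ℚ.* ∑q Ω (λ z → ∑q moves (λ m → walk t (F m x) z) ℚ.* kernel z y)
      ≡⟨ ∑ℚ.∑-*ˡ w Ω _ ⟨
    ∑q Ω (λ z → w ℚ.* (∑q moves (λ m → walk t (F m x) z) ℚ.* kernel z y))
      ≡⟨ ∑ℚ.∑-cong Ω (λ z → ≡-sym (ℚ.*-assoc w _ (kernel z y))) ⟩
    ∑q Ω (λ z → walk (suc t) x z ℚ.* kernel z y)  ∎
    where open ≡-Reasoning

  -- A symmetric kernel with unit row sums also has unit column sums, and this passes to its powers:
  -- the uniform distribution is stationary.
  walk-column : (∀ {x y} → x ∈ₗ Ω → y ∈ₗ Ω → kernel x y ≡ kernel y x) →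
                ∀ t {y} → y ∈ₗ Ω → ∑q Ω (λ x → walk t x y) ≡ 1ℚ
  walk-column symmetric zero {y} y∈Ω = trans (∑ℚ.∑-cong Ω flip) (∑-δ₁ y∈Ω)
    where
    flip : ∀ x → ⟦ x ≟ y ⟧q ≡ ⟦ y ≟ x ⟧q
    flip x with x ≟ y
    ... | yes refl = ≡-sym (if-yes (y ≟ y) refl)
    ... | no x≢y   = ≡-sym (if-no (y ≟ x) (x≢y ∘ ≡-sym))
  walk-column symmetric (suc t) {y} y∈Ω = begin
    ∑q Ω (λ x → walk (suc t) x y)                          ≡⟨ ∑ℚ.∑-cong-∈ Ω (λ x∈Ω → walk-last t x∈Ω y) ⟩
    ∑q Ω (λ x → ∑q Ω λ z → walk t x z ℚ.* kernel z y)      ≡⟨ ∑ℚ.∑-swap Ω Ω (λ x z → walk t x z ℚ.* kernel z y) ⟩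
    ∑q Ω (λ z → ∑q Ω λ x → walk t x z ℚ.* kernel z y)      ≡⟨ ∑ℚ.∑-cong Ω (λ z → ∑ℚ.∑-*ʳ (kernel z y) Ω (λ x → walk t x z)) ⟩
    ∑q Ω (λ z → ∑q Ω (λ x → walk t x z) ℚ.* kernel z y)    ≡⟨ ∑ℚ.∑-cong-∈ Ω (λ {z} z∈Ω → cong (ℚ._* kernel z y) (walk-column symmetric t z∈Ω)) ⟩
    ∑q Ω (λ z → 1ℚ ℚ.* kernel z y)                         ≡⟨ ∑ℚ.∑-cong-∈ Ω (λ {z} z∈Ω → trans (ℚ.*-identityˡ _) (symmetric z∈Ω y∈Ω)) ⟩
    ∑q Ω (kernel y)                                        ≡⟨ kernel-row y∈Ω ⟩
    1ℚ                                                     ∎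
    where open ≡-Reasoning

  w^ : ℕ → ℚ
  w^ zero    = 1ℚ
  w^ (suc t) = w ℚ.* w^ t

  0≤w^ : ∀ t → 0ℚ ℚ.≤ w^ t
  0≤w^ zero    = ℚ.<⇒≤ (ℚ.positive⁻¹ 1ℚ)
  0≤w^ (suc t) = *-0≤ 0≤w (0≤w^ t)

  w^-inv : ∀ t → w^ t ℚ.* ι (length moves ^ t) ≡ 1ℚ
  w^-inv zero    = refl
  w^-inv (suc t) = begin
    w ℚ.* w^ t ℚ.* ι (L * L ^ t)              ≡⟨ cong (w ℚ.* w^ t ℚ.*_) (ι-* L (L ^ t)) ⟩
    w ℚ.* w^ t ℚ.* (ι L ℚ.* ι (L ^ t))        ≡⟨ solve 4 (λ a b c d → a :* b :* (c :* d) := (a :* c) :* (b :* d)) refl w (w^ t) (ι L) (ι (L ^ t)) ⟩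
    w ℚ.* ι L ℚ.* (w^ t ℚ.* ι (L ^ t))        ≡⟨ cong₂ ℚ._*_ w-inv (w^-inv t) ⟩
    1ℚ                                        ∎
    where
    open ≡-Reasoning
    open ℚ-Solver using (solve; _:=_; _:*_)
    L : ℕ
    L = length moves

  ∣δ∣ : ∀ x y → ∣ ⟦ x ≟ y ⟧q ∣ ≡ ⟦ x ≟ y ⟧q
  ∣δ∣ x y with does (x ≟ y)
  ... | true  = refl
  ... | false = refl

  -- The same map moves both walks, so the triangle inequality passes to the pairs after one map.
  -- The factor 2 is the distance bound for two distinct point masses at time zero, as total
  -- variation is not yet halved.
  walk-coupling : ∀ t {x z} → x ∈ₗ Ω → z ∈ₗ Ω →
    ∑q Ω (λ y → ∣ walk t x y ℚ.- walk t z y ∣) ℚ.≤ w^ t ℚ.* (2ℚ ℚ.* ι (uncoupled t x z))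
  walk-coupling zero {x} {z} x∈Ω z∈Ω with x ≟ z
  ... | yes refl = ℚ.≤-reflexive (trans
    (∑ℚ.∑-cong Ω (λ y → cong ∣_∣ (ℚ.+-inverseʳ ⟦ x ≟ y ⟧q))) (∑ℚ.∑-zero Ω))
  ... | no _ = begin
    ∑q Ω (λ y → ∣ ⟦ x ≟ y ⟧q ℚ.- ⟦ z ≟ y ⟧q ∣)              ≤⟨ ∑ℚ.∑-mono-∈ Ω (λ {y} _ → ℚ.∣p-q∣≤∣p∣+∣q∣ ⟦ x ≟ y ⟧q ⟦ z ≟ y ⟧q) ⟩
    ∑q Ω (λ y → ∣ ⟦ x ≟ y ⟧q ∣ ℚ.+ ∣ ⟦ z ≟ y ⟧q ∣)          ≡⟨ ∑ℚ.∑-cong Ω (λ y → cong₂ ℚ._+_ (∣δ∣ x y) (∣δ∣ z y)) ⟩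
    ∑q Ω (λ y → ⟦ x ≟ y ⟧q ℚ.+ ⟦ z ≟ y ⟧q)                  ≡⟨ ∑ℚ.∑-+ Ω (λ y → ⟦ x ≟ y ⟧q) (λ y → ⟦ z ≟ y ⟧q) ⟩
    ∑q Ω (λ y → ⟦ x ≟ y ⟧q) ℚ.+ ∑q Ω (λ y → ⟦ z ≟ y ⟧q)     ≡⟨ cong₂ ℚ._+_ (∑-δ₁ x∈Ω) (∑-δ₁ z∈Ω) ⟩
    2ℚ                                                      ∎
    where open ℚ.≤-Reasoning
  walk-coupling (suc t) {x} {z} x∈Ω z∈Ω = begin
    ∑q Ω (λ y → ∣ walk (suc t) x y ℚ.- walk (suc t) z y ∣)
      ≤⟨ ∑ℚ.∑-mono-∈ Ω (λ {y} _ → one-step y) ⟩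
    ∑q Ω (λ y → w ℚ.* ∑q moves (λ m → d m y))
      ≡⟨ ∑ℚ.∑-*ˡ w Ω _ ⟩
    w ℚ.* ∑q Ω (λ y → ∑q moves (λ m → d m y))
      ≡⟨ cong (w ℚ.*_) (∑ℚ.∑-swap Ω moves (λ y m → d m y)) ⟩
    w ℚ.* ∑q moves (λ m → ∑q Ω (d m))
      ≤⟨ *-monoˡ-0≤ 0≤w (∑ℚ.∑-mono-∈ moves λ {m} _ → walk-coupling t (F-closed m x∈Ω) (F-closed m z∈Ω)) ⟩
    w ℚ.* ∑q moves (λ m → w^ t ℚ.* (2ℚ ℚ.* ι (u m)))
      ≡⟨ cong (w ℚ.*_) (trans (∑ℚ.∑-*ˡ (w^ t) moves (λ m → 2ℚ ℚ.* ι (u m))) (cong (w^ t ℚ.*_) (∑ℚ.∑-*ˡ 2ℚ moves (ι ∘ u)))) ⟩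
    w ℚ.* (w^ t ℚ.* (2ℚ ℚ.* ∑q moves (ι ∘ u)))
      ≡⟨ ℚ.*-assoc w (w^ t) _ ⟨
    w^ (suc t) ℚ.* (2ℚ ℚ.* ∑q moves (ι ∘ u))
      ≡⟨ cong (λ s → w^ (suc t) ℚ.* (2ℚ ℚ.* s)) (ι-∑ moves u) ⟨
    w^ (suc t) ℚ.* (2ℚ ℚ.* ι (uncoupled (suc t) x z))  ∎
    where
    open ℚ.≤-Reasoning
    u : Mv → ℕ
    u m = uncoupled t (F m x) (F m z)
    d : Mv → A → ℚ
    d m y = ∣ walk t (F m x) y ℚ.- walk t (F m z) y ∣
    one-step : ∀ y → ∣ walk (suc t) x y ℚ.- walk (suc t) z y ∣ ℚ.≤ w ℚ.* ∑q moves (λ m → d m y)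
    one-step y = begin
      ∣ w ℚ.* a ℚ.- w ℚ.* b ∣       ≡⟨ cong ∣_∣ (≡-sym (*-distribˡ-minus w a b)) ⟩
      ∣ w ℚ.* (a ℚ.- b) ∣           ≡⟨ ∣*∣-0≤ 0≤w (a ℚ.- b) ⟩
      w ℚ.* ∣ a ℚ.- b ∣             ≡⟨ cong (λ s → w ℚ.* ∣ s ∣) (≡-sym (∑q-minus moves (λ m → walk t (F m x) y) (λ m → walk t (F m z) y))) ⟩
      w ℚ.* ∣ ∑q moves (λ m → walk t (F m x) y ℚ.- walk t (F m z) y) ∣
                                    ≤⟨ *-monoˡ-0≤ 0≤w (∑q-∣∣ moves (λ m → walk t (F m x) y ℚ.- walk t (F m z) y)) ⟩
      w ℚ.* ∑q moves (λ m → d m y)  ∎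
      where
      a b : ℚ
      a = ∑q moves (λ m → walk t (F m x) y)
      b = ∑q moves (λ m → walk t (F m z) y)

  module _ (symmetric : ∀ {x y} → x ∈ₗ Ω → y ∈ₗ Ω → kernel x y ≡ kernel y x)
           (u : ℚ) (0≤u : 0ℚ ℚ.≤ u) (u-inv : u ℚ.* ι (length Ω) ≡ 1ℚ) where

    -- By stationarity the uniform distribution is the average of the walks from all
    -- starting points.
    walk-uniform : ∀ t {x y} → y ∈ₗ Ω →
      walk t x y ℚ.- u ≡ u ℚ.* ∑q Ω (λ z → walk t x y ℚ.- walk t z y)
    walk-uniform t {x} {y} y∈Ω = begin
      p ℚ.- u                                            ≡⟨ cong₂ ℚ._-_ (≡-sym (ℚ.*-identityˡ p)) (≡-sym (ℚ.*-identityʳ u)) ⟩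
      1ℚ ℚ.* p ℚ.- u ℚ.* 1ℚ                              ≡⟨ cong₂ (λ a b → a ℚ.* p ℚ.- u ℚ.* b) (≡-sym u-inv) (≡-sym (walk-column symmetric t y∈Ω)) ⟩
      u ℚ.* ι (length Ω) ℚ.* p ℚ.- u ℚ.* s               ≡⟨ cong (ℚ._- u ℚ.* s) (ℚ.*-assoc u (ι (length Ω)) p) ⟩
      u ℚ.* (ι (length Ω) ℚ.* p) ℚ.- u ℚ.* s             ≡⟨ cong (λ a → u ℚ.* a ℚ.- u ℚ.* s) (≡-sym (∑q-const Ω p)) ⟩
      u ℚ.* ∑q Ω (λ _ → p) ℚ.- u ℚ.* s                   ≡⟨ *-distribˡ-minus u (∑q Ω (λ _ → p)) s ⟨
      u ℚ.* (∑q Ω (λ _ → p) ℚ.- s)                       ≡⟨ cong (u ℚ.*_) (≡-sym (∑q-minus Ω (λ _ → p) (λ z → walk t z y))) ⟩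
      u ℚ.* ∑q Ω (λ z → p ℚ.- walk t z y)                ∎
      where
      open ≡-Reasoning
      p s : ℚ
      p = walk t x y
      s = ∑q Ω (λ z → walk t z y)

    tv-bound : ∀ t {x} → x ∈ₗ Ω → (∀ {z} → z ∈ₗ Ω → 4 * uncoupled t x z ≤ length moves ^ t) →
               ½ ℚ.* ∑q Ω (λ y → ∣ walk t x y ℚ.- u ∣) ℚ.≤ ℤ.+ 1 ℚ./ 4
    -- The sum is at most `½`, being twice a probability of at most 1/4, and `½ * ½` computes to
    -- 1/4.
    tv-bound t {x} x∈Ω coupled = *-monoˡ-0≤ {½} {_} {½} 0≤½ (begin
      ∑q Ω (λ y → ∣ walk t x y ℚ.- u ∣)
        ≤⟨ ∑ℚ.∑-mono-∈ Ω (λ {y} y∈Ω → average y∈Ω) ⟩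
      ∑q Ω (λ y → u ℚ.* ∑q Ω (λ z → d z y))
        ≡⟨ trans (∑ℚ.∑-*ˡ u Ω _) (cong (u ℚ.*_) (∑ℚ.∑-swap Ω Ω (λ y z → d z y))) ⟩
      u ℚ.* ∑q Ω (λ z → ∑q Ω (d z))
        ≤⟨ *-monoˡ-0≤ 0≤u (∑ℚ.∑-mono-∈ Ω λ z∈Ω → ℚ.≤-trans (walk-coupling t x∈Ω z∈Ω) (small z∈Ω)) ⟩
      u ℚ.* ∑q Ω (λ _ → ½)
        ≡⟨ cong (u ℚ.*_) (∑q-const Ω ½) ⟩
      u ℚ.* (ι (length Ω) ℚ.* ½)
        ≡⟨ ℚ.*-assoc u _ ½ ⟨
      u ℚ.* ι (length Ω) ℚ.* ½
        ≡⟨ cong (ℚ._* ½) u-inv ⟩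
      1ℚ ℚ.* ½
        ≡⟨⟩
      ½ ∎)
      where
      open ℚ.≤-Reasoning
      0≤½ : 0ℚ ℚ.≤ ½
      0≤½ = ℚ.<⇒≤ (ℚ.positive⁻¹ ½)
      d : A → A → ℚ
      d z y = ∣ walk t x y ℚ.- walk t z y ∣
      average : ∀ {y} → y ∈ₗ Ω → ∣ walk t x y ℚ.- u ∣ ℚ.≤ u ℚ.* ∑q Ω (λ z → d z y)
      average {y} y∈Ω = begin
        ∣ walk t x y ℚ.- u ∣                                     ≡⟨ cong ∣_∣ (walk-uniform t y∈Ω) ⟩
        ∣ u ℚ.* ∑q Ω (λ z → walk t x y ℚ.- walk t z y) ∣         ≡⟨ ∣*∣-0≤ 0≤u _ ⟩
        u ℚ.* ∣ ∑q Ω (λ z → walk t x y ℚ.- walk t z y) ∣         ≤⟨ *-monoˡ-0≤ 0≤u (∑q-∣∣ Ω (λ z → walk t x y ℚ.- walk t z y)) ⟩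
        u ℚ.* ∑q Ω (λ z → d z y)                                 ∎
      small : ∀ {z} → z ∈ₗ Ω → w^ t ℚ.* (2ℚ ℚ.* ι (uncoupled t x z)) ℚ.≤ ½
      small {z} z∈Ω = begin
        w^ t ℚ.* (2ℚ ℚ.* ι U)                  ≡⟨ solve 2 (λ a b → a :* (con 2ℚ :* b) := con ½ :* (a :* (con (ι 4) :* b))) refl (w^ t) (ι U) ⟩
        ½ ℚ.* (w^ t ℚ.* (ι 4 ℚ.* ι U))         ≡⟨ cong (λ s → ½ ℚ.* (w^ t ℚ.* s)) (ι-* 4 U) ⟨
        ½ ℚ.* (w^ t ℚ.* ι (4 * U))             ≤⟨ *-monoˡ-0≤ 0≤½ (*-monoˡ-0≤ (0≤w^ t) (ι-mono (coupled z∈Ω))) ⟩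
        ½ ℚ.* (w^ t ℚ.* ι (length moves ^ t))  ≡⟨ cong (½ ℚ.*_) (w^-inv t) ⟩
        ½ ℚ.* 1ℚ                               ≡⟨⟩
        ½                                      ∎
        where
        open ℚ-Solver using (solve; _:=_; _:*_; con)
        U : ℕ
        U = uncoupled t x z

-- The Kempe dynamics

-- In this form completeness and uniqueness of the enumeration follow from the general facts about
-- product lists.
allCols-suc : ∀ n k → allCols (suc n) k ≡ cartesianProductWith _∷_ (allFin k) (allCols n k)
allCols-suc n k = go (allFin k)
  where
  go : ∀ cs → concatMap (λ c → map (c ∷_) (allCols n k)) cs ≡ cartesianProductWith _∷_ cs (allCols n k)
  go []       = refl
  go (c ∷ cs) = cong (map (c ∷_) (allCols n k) ++_) (go cs)

allCols-complete : ∀ {n k} (σ : Col n k) → σ ∈ₗ allCols n k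
allCols-complete []                    = here refl
allCols-complete {suc n} {k} (c ∷ σ) = subst (c ∷ σ ∈ₗ_) (≡-sym (allCols-suc n k))
  (∈-cartesianProductWith⁺ _∷_ (∈-allFin c) (allCols-complete σ))

allCols-unique : ∀ n k → Unique (allCols n k)
allCols-unique zero    k = [] ∷ []
allCols-unique (suc n) k = subst Unique (≡-sym (allCols-suc n k))
  (Unique.cartesianProductWith⁺ _∷_ Vec.∷-injective (Unique.allFin⁺ k) (allCols-unique n k))

module _ {n : ℕ} (G : Graph n) where

  isProperB-sound : ∀ {k} (σ : Col n k) → isProperB G σ ≡ true → IsProper G σ
  isProperB-sound σ e u v uv same = true≢false (allFin?-true _ (allFin?-true _ e u) v)
    (cong not (cong₂ _∧_ uv (dec-true (lookup σ u ≟F lookup σ v) same)))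

  isProperB-complete : ∀ {k} (σ : Col n k) → IsProper G σ → isProperB G σ ≡ true
  isProperB-complete σ proper = allFin?-intro _ λ u → allFin?-intro _ λ v → edge u v
    where
    edge : ∀ u v → not (adj G u v ∧ (lookup σ u ==F lookup σ v)) ≡ true
    edge u v with adj G u v in uv
    ... | false = refl
    ... | true  = cong not (dec-false (lookup σ u ≟F lookup σ v) (proper u v uv))

  module _ (k : ℕ) where

    Ω : List (Col n k)
    Ω = properCols G k

    Ω-unique : Unique Ω
    Ω-unique = Unique.filter⁺ (λ σ → isProperB G σ Bool.≟ true) (allCols-unique n k)

    proper⇒∈Ω : ∀ {σ} → IsProper G σ → σ ∈ₗ Ω
    proper⇒∈Ω {σ} proper =
      ∈-filter⁺ (λ σ → isProperB G σ Bool.≟ true) (allCols-complete σ) (isProperB-complete σ proper)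

    ∈Ω⇒proper : ∀ {σ} → σ ∈ₗ Ω → IsProper G σ
    ∈Ω⇒proper {σ} σ∈Ω = isProperB-sound σ
      (proj₂ (∈-filter⁻ (λ σ → isProperB G σ Bool.≟ true) {xs = allCols n k} σ∈Ω))

  module KempeWalk (k : ℕ) (nk>0 : 0 < n * k) (r : Fin n → ℕ) (peo : PEO G (λ _ → true) n r) where

    open Moves {k = k} G r peo

    w : ℚ
    w = inv (n * k)

    w-inv : w ℚ.* ι (length (moves n k)) ≡ 1ℚ
    w-inv rewrite length-moves n k = inv-ι′ nk>0
      where
      inv-ι′ : ∀ {m} → 0 < m → inv m ℚ.* ι m ≡ 1ℚ
      inv-ι′ {suc m} _ = inv-ι m

    open RandomMaps (≡-decV _≟F_) (Ω k) (Ω-unique k) (moves n k) move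
      (λ m σ∈Ω → proper⇒∈Ω k (move-proper m (∈Ω⇒proper k σ∈Ω))) w (0≤inv (n * k)) w-inv public

    moves-unique : Unique (moves n k)
    moves-unique = Unique.cartesianProduct⁺ (Unique.allFin⁺ n) (Unique.allFin⁺ k)

    ∈-moves : ∀ m → m ∈ₗ moves n k
    ∈-moves (v , c) = ∈-cartesianProduct⁺ (∈-allFin v) (∈-allFin c)

    -- The sum over moves has exactly one nonzero term if the colourings are Kempe-adjacent, by
    -- `move-unique`, and none otherwise. Distinctness matters because many moves may fix `α`.
    kernel≡offDiag : ∀ {α β} → IsProper G α → α ≢ β → kernel α β ≡ offDiag G α β
    kernel≡offDiag {α} {β} proper α≢β = split (kempeAdjB G α β) refl
      where
      open ≡-Reasoning
      hit : Fin n × Fin k → ℚ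
      hit m = ⟦ ≡-decV _≟F_ (move m α) β ⟧q
      split : ∀ b → kempeAdjB G α β ≡ b → kernel α β ≡ (if b then w else 0ℚ)
      split true e with KempeAdj⇒move (kempeAdjB-sound G α β e)
      ... | m₀ , e₀ = begin
        w ℚ.* ∑q (moves n k) hit  ≡⟨ cong (w ℚ.*_) (∑ℚ.∑-single moves-unique (∈-moves m₀) {f = hit}
                                       λ {m} m≢m₀ → if-no (≡-decV _≟F_ (move m α) β)
                                         λ e → m≢m₀ (move-unique proper α≢β e e₀)) ⟩
        w ℚ.* hit m₀              ≡⟨ cong (w ℚ.*_) (if-yes (≡-decV _≟F_ (move m₀ α) β) e₀) ⟩
        w ℚ.* 1ℚ                  ≡⟨ ℚ.*-identityʳ w ⟩
        w                         ∎
      split false e = begin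
        w ℚ.* ∑q (moves n k) hit        ≡⟨ cong (w ℚ.*_) (∑ℚ.∑-cong (moves n k) λ m →
                                             if-no (≡-decV _≟F_ (move m α) β)
                                               λ e′ → true≢false (kempeAdjB-complete G α β (move⇒KempeAdj {m} α≢β e′)) e) ⟩
        w ℚ.* ∑q (moves n k) (λ _ → 0ℚ) ≡⟨ cong (w ℚ.*_) (∑ℚ.∑-zero (moves n k)) ⟩
        w ℚ.* 0ℚ                        ≡⟨ ℚ.*-zeroʳ w ⟩
        0ℚ                              ∎

    kernel-symmetric : ∀ {α β} → α ∈ₗ Ω k → β ∈ₗ Ω k → kernel α β ≡ kernel β α
    kernel-symmetric {α} {β} α∈Ω β∈Ω with ≡-decV _≟F_ α β
    ... | yes refl = refl
    ... | no α≢β = trans (kernel≡offDiag (∈Ω⇒proper k α∈Ω) α≢β)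
      (trans (cong (if_then w else 0ℚ) (kempeAdjB-sym G α β))
             (≡-sym (kernel≡offDiag (∈Ω⇒proper k β∈Ω) (α≢β ∘ ≡-sym))))

    P≡kernel : ∀ {α} → α ∈ₗ Ω k → ∀ β → P G k α β ≡ kernel α β
    P≡kernel {α} α∈Ω β = split (≡-decV _≟F_ α β)
      where
      off : ∀ γ → (if α ==C γ then 0ℚ else offDiag G α γ) ≡ (if α ==C γ then 0ℚ else kernel α γ)
      off γ = if-cong-else (≡-decV _≟F_ α γ) λ α≢γ → ≡-sym (kernel≡offDiag (∈Ω⇒proper k α∈Ω) α≢γ)
      split : Dec (α ≡ β) → P G k α β ≡ kernel α β
      split (no α≢β) = trans (if-no (≡-decV _≟F_ α β) α≢β)
                             (≡-sym (kernel≡offDiag (∈Ω⇒proper k α∈Ω) α≢β))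
      split (yes refl) = trans (if-yes (≡-decV _≟F_ α α) refl)
        (trans (cong (λ s → 1ℚ ℚ.- s) (∑ℚ.∑-cong (Ω k) off)) (≡-sym (kernel-diagonal α∈Ω)))

    dist≡walk : ∀ t {x} → x ∈ₗ Ω k → ∀ y → dist G k x t y ≡ walk t x y
    dist≡walk zero    x∈Ω y = refl
    dist≡walk (suc t) x∈Ω y = trans
      (∑ℚ.∑-cong-∈ (Ω k) λ {z} z∈Ω → cong₂ ℚ._*_ (dist≡walk t x∈Ω z) (P≡kernel z∈Ω y))
      (≡-sym (walk-last t x∈Ω y))

    tvDist-bound : ∀ t {x} → x ∈ₗ Ω k →
      (∀ {z} → z ∈ₗ Ω k → 4 * Coupling.uncoupled (≡-decV _≟F_) (moves n k) move t x z ≤ length (moves n k) ^ t) →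
      tvDist G k x t ℚ.≤ ℤ.+ 1 ℚ./ 4
    tvDist-bound t {x} x∈Ω coupled = ℚ.≤-trans
      (ℚ.≤-reflexive (cong (½ ℚ.*_) (∑ℚ.∑-cong (Ω k) λ y → cong (λ p → ∣ p ℚ.- uniform G k y ∣) (dist≡walk t x∈Ω y))))
      (tv-bound kernel-symmetric (inv (length (Ω k))) (0≤inv (length (Ω k))) (inv-length x∈Ω) t x∈Ω coupled)
      where
      -- The starting colouring shows that the list is nonempty, so the default value
      -- `inv zero = 0ℚ` does not occur.
      inv-length : ∀ {xs : List (Col n k)} → x ∈ₗ xs → inv (length xs) ℚ.* ι (length xs) ≡ 1ℚ
      inv-length {_ ∷ xs} _ = inv-ι (length xs)

theorem3 : Σ ℕ λ C →
    (n : ℕ) (G : Graph n) (ω k : ℕ) →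
    Chordal G → IsCliqueNumber G ω → ω ≤ k →
    MixingTimeAtMost G k (C * ω * (n * n))
theorem3 = 4 , mixing
  where
  mixing : (n : ℕ) (G : Graph n) (ω k : ℕ) → Chordal G → IsCliqueNumber G ω → ω ≤ k →
           MixingTimeAtMost G k (4 * ω * (n * n))
  -- Without vertices `n * k` is zero and the moves carry no weight. The empty colouring is the only
  -- state, and the distance at time 0 computes to zero.
  mixing zero G ω k _ _ _ = 0 , z≤n , λ { [] _ → ℚ.<⇒≤ (ℚ.positive⁻¹ (ℤ.+ 1 ℚ./ 4)) }
  mixing n@(suc _) G ω k chordal (_ , cliques≤) ω≤k = T , ℕ.≤-refl , λ x px →
    tvDist-bound T (proper⇒∈Ω G k px) (λ z∈Ω → few px (∈Ω⇒proper G k z∈Ω))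
    where
    T : ℕ
    T = 4 * ω * (n * n)
    r : Fin n → ℕ
    r = proj₁ (PEO-exists G chordal n (λ _ → true) (cardB≤n (λ _ → true)))
    peo : PEO G (λ _ → true) n r
    peo = proj₂ (PEO-exists G chordal n (λ _ → true) (cardB≤n (λ _ → true)))
    ω>0 : 0 < ω
    ω>0 = cliques≤ (zero ∷ []) ([] ∷ [] , [] ∷ [])
    open KempeWalk G k (ℕ.*-mono-≤ {1} {n} (s≤s z≤n) (ℕ.≤-trans ω>0 ω≤k)) r peo using (tvDist-bound)
    open Moves {k = k} G r peo using (move)
    few : ∀ {x z} → IsProper G x → IsProper G z →
          4 * Coupling.uncoupled (≡-decV _≟F_) (moves n k) move T x z ≤ length (moves n k) ^ T
    -- The time `T` is four times the bound `n * ω * n` of `uncoupled-bound`, which starts from the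
    -- empty segment with `j = n`; cancelling `ω * (n * n)` leaves the factor 4.
    few {x} {z} px pz = ℕ.*-cancelˡ-≤ (ω * (n * n)) ⦃ ℕ.>-nonZero (ℕ.*-mono-≤ {1} {ω} {1} ω>0 (s≤s z≤n)) ⦄ (begin
      ω * (n * n) * (4 * U)       ≡⟨ solve 3 (λ o m u → o :* (m :* m) :* (con 4 :* u) := con 4 :* o :* (m :* m) :* u) refl ω n U ⟩
      T * U                       ≤⟨ uncoupled-bound G cliques≤ r peo ω≤k T n {0} {x} {z} px pz refl (λ ()) ⟩
      n * ω * N * n               ≡⟨ solve 3 (λ o m p → m :* o :* p :* m := o :* (m :* m) :* p) refl ω n N ⟩
      ω * (n * n) * N             ∎)
      where
      open ℕ.≤-Reasoning
      open +-*-Solver using (solve; _:=_; _:*_; con)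
      U N : ℕ
      U = Coupling.uncoupled (≡-decV _≟F_) (moves n k) move T x z
      N = length (moves n k) ^ T
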